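{- Let $r,s\ge 1$ and $t\ge 2$ be integers, and let $\rho\in\mathcal{P}_{r,s}$ be a $t$-core. Let $\mathcal{D}^t_{r,s}(\rho)=\{\lambda\in\mathcal{P}_{r,s}\mid \mathrm{core}_t(\lambda)=\rho\}$. Let $n_i=\left\lfloor\frac{r+s+t-1-i}{t}\right\rfloor$ for $0\le i\le t-1$, and let $a_i=|v^i|$, where $(v^0,\dots,v^{t-1})$ is the $t$-tuple of binary words associated to $\rho$ (as a partition in $\mathcal{P}_{r,s}$). Then the number of partitions in $\mathcal{D}^t_{r,s}(\rho)$ is $$\prod_{i=0}^{t-1}\binom{n_i}{a_i}.$$
   Context: A partition $\lambda=(\lambda_1\ge\lambda_2\ge\cdots)$ is a weakly decreasing finite sequence of positive integers (possibly empty), extended by $\lambda_j=0$ for $j>\ell(\lambda)$, where $\ell(\lambda)$ is the number of parts. $\mathcal{P}_{r,s}$ is the set of partitions with $\ell(\lambda)\le r$ and $\lambda_1\le s$. A rim-hook of $\lambda$ is a connected skew shape $\lambda/\mu$ (with $\mu\subseteq\lambda$ a partition) containing no $2\times2$ block of boxes; a $t$-rim hook is one with exactly $t$ boxes. The $t$-core $\mathrm{core}_t(\lambda)$ is the partition obtained by successively removing $t$-rim hooks until none can be removed (it does not depend on the order of removals); $\lambda$ is a $t$-core if $\mathrm{core}_t(\lambda)=\lambda$. Words associated to a partition $\lambda\in\mathcal{P}_{r,s}$: the balanced abacus of $\lambda$ is the word $w=(w_m)_{m\in\mathbb{Z}}$ in $\{0,1\}$ with $w_m=1$ if $m=\lambda_j-j$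 for some $j\ge1$ and $w_m=0$ otherwise (equivalently, it traces the boundary of $\lambda$ with $1$ for an up step and $0$ for a right step, normalised so that $|\{m\ge0: w_m=1\}|=|\{m<0:w_m=0\}|$). With $n_i=\left\lfloor\frac{r+s+t-1-i}{t}\right\rfloor$, set $$v^i=(w_{ -r+i},\,w_{ -r+i+t},\,\dots,\,w_{ -r+i+t(n_i-1)}),\qquad 0\le i\le t-1.$$ For a binary word $v$, $|v|$ denotes the number of $1$'s in $v$. -}

module Defs where

open import Data.Bool using (Bool; true)
open import Data.Bool.Properties as Bool using ()
open import Data.Fin using (toℕ)
open import Data.Integer as ℤ using (ℤ; +_)
import Data.Integer.Properties as ℤ
open import Data.List using (List; []; _∷_; length)
open import Data.List.Membership.Propositional using (_∈_)
open import Data.List.Relation.Unary.All using (All)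
open import Data.List.Relation.Unary.Linked using (Linked)
open import Data.List.Relation.Unary.Unique.Propositional using (Unique)
open import Data.Nat
import Data.Nat.Properties as ℕ
open import Data.Nat.ListAction using (sum)
open import Data.Product using (Σ-syntax; ∃-syntax; _×_; _,_)
open import Data.Vec using (Vec; tabulate; count)
open import Function using (_⇔_)
open import Relation.Binary.Construct.Closure.ReflexiveTransitive using (Star)
open import Relation.Binary.PropositionalEquality
open import Relation.Nullary using (¬_; Dec; does)
open import Relation.Nullary.Decidable using (map′)

HasCardinality : {A : Set} → (A → Set) → ℕ → Set
HasCardinality {A} P n =
  Σ[ xs ∈ List A ] Unique xs × (∀ x → x ∈ xs ⇔ P x) × length xs ≡ n

record Partition : Set where
  constructor mkPartition
  field
    parts      : List ℕ
    decreasing : Linked _≥_ parts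
    positive   : All (0 <_) parts

open Partition public

nth : List ℕ → ℕ → ℕ
nth []       _       = 0
nth (x ∷ _)  zero    = x
nth (_ ∷ xs) (suc k) = nth xs k

-- Rows are counted from zero: row α k is the (k+1)-st part, zero past the end.
row : Partition → ℕ → ℕ
row α = nth (parts α)

ℓ : Partition → ℕ
ℓ α = length (parts α)

_∈𝒫[_,_] : Partition → ℕ → ℕ → Set
α ∈𝒫[ r , s ] = ℓ α ≤ r × row α 0 ≤ s

_⊆_ : Partition → Partition → Set
μ ⊆ α = ∀ k → row μ k ≤ row α k

-- (row , column), both counted from zero.
Box : Set
Box = ℕ × ℕ

_∈_∖_ : Box → Partition → Partition → Set
(i , j) ∈ α ∖ μ = row μ i ≤ j × j < row α i

data Adjacent : Box → Box → Set where
  right : ∀ {i j} → Adjacent (i , j) (i , suc j)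
  left  : ∀ {i j} → Adjacent (i , suc j) (i , j)
  down  : ∀ {i j} → Adjacent (i , j) (suc i , j)
  up    : ∀ {i j} → Adjacent (suc i , j) (i , j)

Connected : Partition → Partition → Set
Connected α μ =
  ∀ b c → b ∈ α ∖ μ → c ∈ α ∖ μ →
  Star (λ x y → x ∈ α ∖ μ × y ∈ α ∖ μ × Adjacent x y) b c

Contains2×2 : Partition → Partition → Set
Contains2×2 α μ = ∃[ i ] ∃[ j ]
  (i , j) ∈ α ∖ μ × (i , suc j) ∈ α ∖ μ ×
  (suc i , j) ∈ α ∖ μ × (suc i , suc j) ∈ α ∖ μ

-- α ∖ μ is a t-rim hook of α, so that μ arises from α by removing it.
record RimHook (t : ℕ) (α μ : Partition) : Set where
  field
    contained : μ ⊆ α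
    connected : Connected α μ
    no2×2     : ¬ Contains2×2 α μ
    size      : HasCardinality (_∈ α ∖ μ) t

-- The graph of core_t: ρ results from α by removing t-rim hooks until none is
-- left.
CoreOf : ℕ → Partition → Partition → Set
CoreOf t α ρ = Star (RimHook t) α ρ × ¬ (∃[ μ ] RimHook t ρ μ)

IsCore : ℕ → Partition → Set
IsCore t ρ = CoreOf t ρ ρ

𝒟 : (r s t : ℕ) → Partition → Partition → Set
𝒟 r s t ρ α = α ∈𝒫[ r , s ] × CoreOf t α ρ

-- m = λ_j − j for some j ≥ 1, with j = k + 1.
Bead : Partition → ℤ → Set
Bead α m = ∃[ k ] m ≡ + row α k ℤ.- + suc k

nth≤sum : ∀ xs k → nth xs k ≤ sum xs
nth≤sum []       k       = z≤n
nth≤sum (x ∷ xs) zero    = ℕ.m≤m+n x (sum xs)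
nth≤sum (x ∷ xs) (suc k) = ℕ.≤-trans (nth≤sum xs k) (ℕ.m≤n+m (sum xs) x)

bead-bound : ∀ α {m} k → m ≡ + row α k ℤ.- + suc k → k < sum (parts α) + ℤ.∣ m ∣
bead-bound α {m} k refl = begin
  ℤ.∣ + suc k ∣                       ≡⟨ cong ℤ.∣_∣ lemma ⟩
  ℤ.∣ + row α k ℤ.- m ∣               ≤⟨ ℤ.∣i-j∣≤∣i∣+∣j∣ (+ row α k) m ⟩
  row α k + ℤ.∣ m ∣                   ≤⟨ ℕ.+-monoˡ-≤ ℤ.∣ m ∣ (nth≤sum (parts α) k) ⟩
  sum (parts α) + ℤ.∣ m ∣             ∎
  where
  open ℕ.≤-Reasoning
  lemma : + suc k ≡ + row α k ℤ.- (+ row α k ℤ.- + suc k)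
  lemma = solve (+ row α k) (+ suc k)
    where
    open import Data.Integer.Tactic.RingSolver using (solve-∀)
    solve : ∀ a b → b ≡ a ℤ.- (a ℤ.- b)
    solve = solve-∀

bead? : ∀ α m → Dec (Bead α m)
bead? α m = map′
  (λ (k , _ , eq) → k , eq)
  (λ (k , eq) → k , bead-bound α k eq , eq)
  (ℕ.anyUpTo? (λ k → m ℤ.≟ + row α k ℤ.- + suc k) (sum (parts α) + ℤ.∣ m ∣))

-- The balanced abacus as a two-sided infinite word, with true for 1.
abacus : Partition → ℤ → Bool
abacus α m = does (bead? α m)

module _ (r s t : ℕ) .{{_ : NonZero t}} where

  -- For i ≤ t − 1 the subtractions do not truncate.
  n : ℕ → ℕ
  n i = (r + s + t ∸ 1 ∸ i) / t

  v : Partition → (i : ℕ) → Vec Bool (n i)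
  v α i = tabulate λ k → abacus α (ℤ.- + r ℤ.+ + i ℤ.+ + (t * toℕ k))

ones : ∀ {m} → Vec Bool m → ℕ
ones = count (Bool._≟ true)

{-# OPTIONS --safe #-}
module Submission where

-- On the abacus of α ∈ 𝒫[ r , s ], removing a t-rim hook moves one bead t places
-- to the left onto a vacant position, and every such move arises this way. Hence
-- the number of beads on each runner (residue class modulo t) is invariant, and a
-- t-core is a configuration with all beads pushed to the left on its runner, so
-- that the runner counts determine it. The partitions in 𝒫[ r , s ] with core ρ
-- are therefore the placements of a_i beads on the n_i positions of runner i, for
-- every i; these are counted by Pascal's rule, adding one position at a time.

open import Defs
open import Data.Bool using (Bool; true; false; if_then_else_)
open import Data.Fin using (toℕ)
import Data.Integer as ℤ
open import Data.Integer using () renaming (+_ to pos)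
import Data.Integer.Properties as ℤ
import Data.Integer.Tactic.RingSolver as ℤ-Solver
open import Data.List using (List; []; _∷_; _++_; length; map; applyUpTo; upTo)
open import Data.List.Membership.Propositional using (_∈_; _∉_; find; lose)
open import Data.List.Membership.Propositional.Properties
  using (∈-map⁺; ∈-map⁻; ∈-++⁺ˡ; ∈-++⁺ʳ; ∈-++⁻; ∈-applyUpTo⁺; ∈-applyUpTo⁻)
open import Data.List.Membership.Propositional.Properties.WithK using (unique∧set⇒bag)
open import Data.List.Properties
  using (length-map; length-++; length-applyUpTo; map-upTo; ∷-injective; ∷-injectiveʳ)
open import Data.List.Relation.Binary.BagAndSetEquality using (∼bag⇒↭)
open import Data.List.Relation.Binary.Permutation.Propositional.Properties using (↭-length)
open import Data.List.Relation.Unary.All as All using (All; []; _∷_)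
open import Data.List.Relation.Unary.AllPairs using ([]; _∷_)
open import Data.List.Relation.Unary.Any using (here; there; any?)
open import Data.List.Relation.Unary.Linked as Linked using (Linked; []; [-]; _∷_)
open import Data.List.Relation.Unary.Unique.Propositional using (Unique)
import Data.List.Relation.Unary.Unique.Propositional.Properties as Unique
open import Data.Nat
open import Data.Nat.Combinatorics using (_C_; nCk+nC[k+1]≡[n+1]C[k+1]; k>n⇒nCk≡0)
open import Data.Nat.Divisibility using (divides-refl)
open import Data.Nat.DivMod
open import Data.Nat.Induction using (<-wellFounded)
open import Data.Nat.ListAction using (sum; product)
open import Data.Nat.Properties
open import Algebra.Properties.CommutativeSemigroup +-commutativeSemigroup
  using () renaming (x∙yz≈y∙xz to +-swapˡ; xy∙z≈xz∙y to +-rightComm; interchange to +-interchange)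
open import Data.Nat.Tactic.RingSolver using (solve-∀)
open import Data.List.Membership.DecPropositional _≟_ using (_∈?_)
open import Data.Product using (∃-syntax; _×_; _,_; proj₁; proj₂; map₁)
open import Data.Sum using (_⊎_; inj₁; inj₂; [_,_]′)
open import Data.Vec using (tabulate)
open import Data.Vec.Properties using (tabulate-cong)
open import Function using (_∘_; _⇔_; mk⇔; Equivalence)
import Function.Properties.Equivalence as ⇔
open import Induction.WellFounded using (Acc; acc)
open import Relation.Binary using (tri<; tri≈; tri>)
open import Relation.Binary.Construct.Closure.ReflexiveTransitive as Star using (Star; ε; _◅_; _◅◅_)
open import Relation.Binary.PropositionalEquality
open import Relation.Nullary using (¬_; Dec; yes; no; does; contradiction; ¬?; _×-dec_)
open import Relation.Nullary.Decidable using (map′; decidable-stable; dec-true; dec-false)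

open Equivalence using (to; from)

-- Rim hooks are given by boxes and the counting is done with beads; `Strip`, an inductive
-- description by row lengths, mediates between the two. Row lengths are functions on `ℕ` rather
-- than partitions, so that deleting the top row is composition with `suc` and the inductions over
-- rows never have to rebuild a partition. Only the beads of the first `r` rows are kept, shifted by
-- `r`. For a partition in the rectangle these are `r` distinct numbers below `r + s`, and every
-- negative position is occupied. The core is given as a relation, so membership in `𝒟` asks for an
-- actual chain of removals ending in `ρ`. Such a chain comes from moving beads until none can move:
-- the final arrangement has the runner counts of `ρ`, whose beads cannot move either, and hence it
-- is that of `ρ`.

private variable
  A B : Set

-- Cardinalities of predicates

cardinality-unique : {P : A → Set} {m n : ℕ} →
  HasCardinality P m → HasCardinality P n → m ≡ n
cardinality-unique (xs , xs! , ∈xs , refl) (ys , ys! , ∈ys , refl) =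
  ↭-length (∼bag⇒↭ (unique∧set⇒bag xs! ys! (λ {x} → ⇔.trans (∈xs x) (⇔.sym (∈ys x)))))

cardinality-⇔ : {P Q : A → Set} {n : ℕ} → (∀ x → P x ⇔ Q x) →
  HasCardinality P n → HasCardinality Q n
cardinality-⇔ P⇔Q (xs , xs! , ∈xs , len) =
  xs , xs! , (λ x → ⇔.trans (∈xs x) (P⇔Q x)) , len

cardinality-∅ : {P : A → Set} → (∀ x → ¬ P x) → HasCardinality P 0
cardinality-∅ ¬P = [] , [] , (λ x → mk⇔ (λ ()) (λ Px → contradiction Px (¬P x))) , refl

cardinality-⊎ : {P Q : A → Set} {m n : ℕ} → (∀ x → P x → ¬ Q x) →
  HasCardinality P m → HasCardinality Q n →
  HasCardinality (λ x → P x ⊎ Q x) (m + n)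
cardinality-⊎ disjoint (xs , xs! , ∈xs , refl) (ys , ys! , ∈ys , refl) =
  xs ++ ys ,
  Unique.++⁺ xs! ys! (λ {x} (p , q) → disjoint x (to (∈xs x) p) (to (∈ys x) q)) ,
  (λ x → mk⇔
    ([ inj₁ ∘ to (∈xs x) , inj₂ ∘ to (∈ys x) ]′ ∘ ∈-++⁻ xs)
    [ ∈-++⁺ˡ ∘ from (∈xs x) , ∈-++⁺ʳ xs ∘ from (∈ys x) ]′) ,
  length-++ xs

cardinality-image : {P : A → Set} {n : ℕ} (f : A → B) →
  (∀ {x y} → f x ≡ f y → x ≡ y) → HasCardinality P n →
  HasCardinality (λ y → ∃[ x ] P x × y ≡ f x) n
cardinality-image f injective (xs , xs! , ∈xs , refl) =
  map f xs , Unique.map⁺ injective xs! ,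
  (λ y → mk⇔
    (λ y∈ → let x , x∈ , eq = ∈-map⁻ f y∈ in x , to (∈xs x) x∈ , eq)
    (λ { (x , Px , refl) → ∈-map⁺ f (from (∈xs x) Px) })) ,
  length-map f xs

-- Applied to the passage from a partition to its beads, which is injective only on `Q` and
-- invertible only on `P`. Preimages are therefore chosen along the enumerating list; mapping `g`
-- over them returns that list, so they are distinct as well.
cardinality-transfer : {P : A → Set} {Q : B → Set} {n : ℕ} (g : B → A) →
  (∀ {y} → Q y → P (g y)) →
  (∀ {y z} → Q y → Q z → g y ≡ g z → y ≡ z) →
  (∀ {x} → P x → ∃[ y ] Q y × g y ≡ x) →
  HasCardinality P n → HasCardinality Q n
cardinality-transfer {P = P} {Q} g QP injective surjective (xs , xs! , ∈xs , refl) =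
  let ys , Qys , gys = preimages xs (λ {x} → to (∈xs x)) in
  ys , Unique.map⁻ (subst Unique (sym gys) xs!) ,
  (λ y → mk⇔ Qys (λ Qy →
    let z , z∈ , eq = ∈-map⁻ g (subst (g y ∈_) (sym gys) (from (∈xs (g y)) (QP Qy)))
    in subst (_∈ ys) (sym (injective Qy (Qys z∈) eq)) z∈)) ,
  trans (sym (length-map g ys)) (cong length gys)
  where
  preimages : ∀ xs → (∀ {x} → x ∈ xs → P x) →
    ∃[ ys ] (∀ {y} → y ∈ ys → Q y) × map g ys ≡ xs
  preimages []       _ = [] , (λ ()) , refl
  preimages (x ∷ xs) P∈ =
    let y , Qy , gy = surjective (P∈ (here refl))
        ys , Qys , gys = preimages xs (P∈ ∘ there)
    in y ∷ ys , (λ { (here refl) → Qy ; (there y∈) → Qys y∈ }) , cong₂ _∷_ gy gys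

-- Row-length functions and finite sums

Antitone : (ℕ → ℕ) → Set
Antitone a = ∀ k → a (suc k) ≤ a k

VanishesFrom : ℕ → (ℕ → ℕ) → Set
VanishesFrom r a = ∀ k → r ≤ k → a k ≡ 0

vanishes-tail : ∀ {r a} → VanishesFrom (suc r) a → VanishesFrom r (a ∘ suc)
vanishes-tail van k r≤k = van (suc k) (s≤s r≤k)

Σ< : ℕ → (ℕ → ℕ) → ℕ
Σ< n f = sum (applyUpTo f n)

Σ<-cong : ∀ n {f g : ℕ → ℕ} → (∀ k → k < n → f k ≡ g k) → Σ< n f ≡ Σ< n g
Σ<-cong zero    f≡g = refl
Σ<-cong (suc n) f≡g = cong₂ _+_ (f≡g 0 z<s) (Σ<-cong n (λ k k<n → f≡g (suc k) (s<s k<n)))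

Σ<-+ : ∀ n (f g : ℕ → ℕ) → Σ< n (λ k → f k + g k) ≡ Σ< n f + Σ< n g
Σ<-+ zero    f g = refl
Σ<-+ (suc n) f g = trans (cong (f 0 + g 0 +_) (Σ<-+ n (f ∘ suc) (g ∘ suc)))
  (+-interchange (f 0) (g 0) (Σ< n (f ∘ suc)) (Σ< n (g ∘ suc)))

Σ<-∸ : ∀ n {f g : ℕ → ℕ} → (∀ k → g k ≤ f k) → Σ< n (λ k → f k ∸ g k) + Σ< n g ≡ Σ< n f
Σ<-∸ n {f} {g} g≤f = trans (sym (Σ<-+ n _ g)) (Σ<-cong n (λ k _ → m∸n+n≡m (g≤f k)))

-- Skew shapes between row-length functions

Skew : (a m : ℕ → ℕ) → Box → Set
Skew a m (i , j) = m i ≤ j × j < a i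

Step : (a m : ℕ → ℕ) → Box → Box → Set
Step a m b c = Skew a m b × Skew a m c × Adjacent b c

nextRow : Box → Box
nextRow = map₁ suc

interval-cardinality : ∀ m a → HasCardinality (λ j → m ≤ j × j < a) (a ∸ m)
interval-cardinality m a =
  applyUpTo (m +_) (a ∸ m) ,
  Unique.applyUpTo⁺₁ (m +_) (a ∸ m) (λ i<j _ eq → <⇒≢ i<j (+-cancelˡ-≡ m _ _ eq)) ,
  (λ j → mk⇔
    (λ j∈ → let k , k< , eq = ∈-applyUpTo⁻ (m +_) j∈ in
      subst (m ≤_) (sym eq) (m≤m+n m k) ,
      subst (_< a) (sym eq) (subst (_≤ a) (+-suc m k)
        (≤-trans (+-monoʳ-≤ m k<) (≤-reflexive (m+[n∸m]≡n (m≤a k<))))))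
    (λ (m≤j , j<a) → subst (_∈ applyUpTo (m +_) (a ∸ m)) (m+[n∸m]≡n m≤j)
      (∈-applyUpTo⁺ (m +_) (∸-monoˡ-< j<a m≤j)))) ,
  length-applyUpTo (m +_) (a ∸ m)
  where
  m≤a : ∀ {k} → k < a ∸ m → m ≤ a
  m≤a k< = <⇒≤ (m∸n≢0⇒n<m (λ eq → m<n⇒n≢0 k< eq))

skew-cardinality : ∀ r a m → VanishesFrom r a →
  HasCardinality (Skew a m) (Σ< r (λ k → a k ∸ m k))
skew-cardinality zero    a m van = cardinality-∅
  (λ (i , j) (_ , j<a) → n≮0 (subst (j <_) (van i z≤n) j<a))
skew-cardinality (suc r) a m van = cardinality-⇔ decompose
  (cardinality-⊎ (λ { _ (_ , _ , refl) (_ , _ , ()) })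
    (cardinality-image (0 ,_) (cong proj₂) (interval-cardinality (m 0) (a 0)))
    (cardinality-image nextRow (λ { refl → refl })
      (skew-cardinality r (a ∘ suc) (m ∘ suc) (vanishes-tail van))))
  where
  decompose : ∀ b →
    ((∃[ j ] (m 0 ≤ j × j < a 0) × b ≡ (0 , j)) ⊎
     (∃[ c ] Skew (a ∘ suc) (m ∘ suc) c × b ≡ nextRow c)) ⇔ Skew a m b
  decompose b = mk⇔
    (λ { (inj₁ (_ , bounds , refl)) → bounds ; (inj₂ (_ , bounds , refl)) → bounds })
    (split b)
    where
    split : ∀ b → Skew a m b →
      (∃[ j ] (m 0 ≤ j × j < a 0) × b ≡ (0 , j)) ⊎
      (∃[ c ] Skew (a ∘ suc) (m ∘ suc) c × b ≡ nextRow c)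
    split (zero  , j) bounds = inj₁ (j , bounds , refl)
    split (suc i , j) bounds = inj₂ ((i , j) , bounds , refl)

-- A rim hook occupies consecutive rows; in all but its last row the new row
-- length is one less than the old length of the row below. The index x is one
-- more than the content of the north-east end of the hook, relative to the
-- current row, so that the last row sees the total length t of the hook.
data Tail (t : ℕ) : ℕ → (a m : ℕ → ℕ) → Set where
  last : ∀ {x a m} → m 0 < a 0 → t + m 0 ≡ x → (∀ k → m (suc k) ≡ a (suc k)) → Tail t x a m
  next : ∀ {x a m} → m 0 < a 0 → suc (m 0) ≡ a 1 → Tail t (suc x) (a ∘ suc) (m ∘ suc) → Tail t x a m

data Strip (t : ℕ) (a m : ℕ → ℕ) : Set where
  here  : Tail t (a 0) a m → Strip t a m
  there : m 0 ≡ a 0 → Strip t (a ∘ suc) (m ∘ suc) → Strip t a m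

tail-head< : ∀ {t x a m} → Tail t x a m → m 0 < a 0
tail-head< (last m<a _ _) = m<a
tail-head< (next m<a _ _) = m<a

tail-cong : ∀ {t x a m m′} → (∀ k → m k ≡ m′ k) → Tail t x a m → Tail t x a m′
tail-cong {t} {a = a} m≡ (last m<a len rest) =
  last (subst (_< a 0) (m≡ 0) m<a) (trans (cong (t +_) (sym (m≡ 0))) len)
    (λ k → trans (sym (m≡ (suc k))) (rest k))
tail-cong {a = a} m≡ (next m<a eq tail) =
  next (subst (_< a 0) (m≡ 0) m<a) (trans (cong suc (sym (m≡ 0))) eq) (tail-cong (m≡ ∘ suc) tail)

strip-cong : ∀ {t a m m′} → (∀ k → m k ≡ m′ k) → Strip t a m → Strip t a m′
strip-cong m≡ (here tail)     = here (tail-cong m≡ tail)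
strip-cong m≡ (there eq strip) = there (trans (sym (m≡ 0)) eq) (strip-cong (m≡ ∘ suc) strip)

tail-≤ : ∀ {t x a m} → Tail t x a m → ∀ k → m k ≤ a k
tail-≤ tail              zero    = <⇒≤ (tail-head< tail)
tail-≤ (last _ _ rest)   (suc k) = ≤-reflexive (rest k)
tail-≤ (next _ _ tail)   (suc k) = tail-≤ tail k

strip-≤ : ∀ {t a m} → Strip t a m → ∀ k → m k ≤ a k
strip-≤ (here tail)     k       = tail-≤ tail k
strip-≤ (there eq _)    zero    = ≤-reflexive eq
strip-≤ (there _ strip) (suc k) = strip-≤ strip k

-- In every row but the last, `a 1` cancels against `suc (m 0)`, and the surplus one goes into the
-- index `x`. For `x ≡ a 0` the equation says that the hook has `t` boxes.
tail-sum : ∀ r {t x a m} → Tail t x a m → VanishesFrom (suc r) a →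
  t + Σ< (suc r) m ≡ x + Σ< r (a ∘ suc)
tail-sum r {t} {a = a} {m} (last _ refl rest) van = trans
  (sym (+-assoc t (m 0) _)) (cong (t + m 0 +_) (Σ<-cong r (λ k _ → rest k)))
tail-sum zero    {a = a} (next _ _ tail) van =
  contradiction (subst (_ <_) (van 1 ≤-refl) (tail-head< tail)) n≮0
tail-sum (suc r) {t} {x} {a} {m} (next _ eq tail) van = begin
  t + (m 0 + Σ< (suc r) (m ∘ suc))       ≡⟨ +-swapˡ t (m 0) _ ⟩
  m 0 + (t + Σ< (suc r) (m ∘ suc))       ≡⟨ cong (m 0 +_) (tail-sum r tail (vanishes-tail van)) ⟩
  m 0 + (suc x + Σ< r (a ∘ suc ∘ suc))   ≡⟨ shift (m 0) x _ ⟩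
  x + (suc (m 0) + Σ< r (a ∘ suc ∘ suc)) ≡⟨ cong (λ z → x + (z + Σ< r (a ∘ suc ∘ suc))) eq ⟩
  x + (a 1 + Σ< r (a ∘ suc ∘ suc))       ∎
  where
  open ≡-Reasoning
  shift : ∀ a b c → a + (suc b + c) ≡ b + (suc a + c)
  shift = solve-∀

strip-sum : ∀ r {t a m} → Strip t a m → VanishesFrom r a → t + Σ< r m ≡ Σ< r a
strip-sum zero    (here tail) van =
  contradiction (subst (_ <_) (van 0 z≤n) (tail-head< tail)) n≮0
strip-sum zero    (there _ strip) van = strip-sum zero strip (λ k _ → van (suc k) z≤n)
strip-sum (suc r) (here tail) van = tail-sum r tail van
strip-sum (suc r) {t} {a} {m} (there eq strip) van = begin
  t + (m 0 + Σ< r (m ∘ suc)) ≡⟨ +-swapˡ t (m 0) _ ⟩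
  m 0 + (t + Σ< r (m ∘ suc)) ≡⟨ cong₂ _+_ eq (strip-sum r strip (vanishes-tail van)) ⟩
  a 0 + Σ< r (a ∘ suc)       ∎
  where open ≡-Reasoning

-- From strips to rim hooks

tail-narrow : ∀ {t x a m} → Tail t x a m →
  ∀ i → m (suc i) < a (suc i) → a (suc i) ≤ suc (m i)
tail-narrow (last _ _ rest) i       m<a = contradiction (rest i) (<⇒≢ m<a)
tail-narrow (next _ eq _)   zero    _   = ≤-reflexive (sym eq)
tail-narrow (next _ _ tail) (suc i) m<a = tail-narrow tail i m<a

-- Excludes 2×2 blocks: consecutive rows of a strip have a single column in common.
strip-narrow : ∀ {t a m} → Strip t a m →
  ∀ i → m i < a i → m (suc i) < a (suc i) → a (suc i) ≤ suc (m i)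
strip-narrow (here tail)     i       _   m<a = tail-narrow tail i m<a
strip-narrow (there eq _)    zero    m<a _   = contradiction eq (<⇒≢ m<a)
strip-narrow (there _ strip) (suc i) m<a m<a′ = strip-narrow strip i m<a m<a′

step-sym : ∀ {a m b c} → Step a m b c → Step a m c b
step-sym (b∈ , c∈ , adj) = c∈ , b∈ , sym-adj adj
  where
  sym-adj : ∀ {b c} → Adjacent b c → Adjacent c b
  sym-adj right = left
  sym-adj left  = right
  sym-adj down  = up
  sym-adj up    = down

step-nextRow : ∀ {a m b c} → Step (a ∘ suc) (m ∘ suc) b c → Step a m (nextRow b) (nextRow c)
step-nextRow (b∈ , c∈ , adj) = b∈ , c∈ , nextRow-adj adj
  where
  nextRow-adj : ∀ {b c} → Adjacent b c → Adjacent (nextRow b) (nextRow c)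
  nextRow-adj right = right
  nextRow-adj left  = left
  nextRow-adj down  = down
  nextRow-adj up    = up

path-nextRow : ∀ {a m b c} → Star (Step (a ∘ suc) (m ∘ suc)) b c → Star (Step a m) (nextRow b) (nextRow c)
path-nextRow {a} {m} = Star.gmap nextRow (step-nextRow {a} {m})

walk-left : ∀ {a m i j j′} → m i ≤ j → j ≤ j′ → j′ < a i → Star (Step a m) (i , j′) (i , j)
walk-left {a} {m} {i} {j} {j′} m≤j j≤j′ j′<a =
  subst (λ z → Star (Step a m) (i , z) (i , j)) (m∸n+n≡m j≤j′)
    (go (j′ ∸ j) (subst (_< a i) (sym (m∸n+n≡m j≤j′)) j′<a))
  where
  go : ∀ d → d + j < a i → Star (Step a m) (i , d + j) (i , j)
  go zero    _   = ε
  go (suc d) <a = ((≤-trans m≤j (m≤n+m j (suc d)) , <a) , (≤-trans m≤j (m≤n+m j d) , <-trans (n<1+n _) <a) , left)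
    ◅ go d (<-trans (n<1+n _) <a)

-- Every box is joined to the left end of the top row. From below, a path arrives at the left end of
-- row 1, runs right to column `m 0`, which is the last one there because `suc (m 0) ≡ a 1`, and
-- steps up.
tail-connected : ∀ {t x a m} → Tail t x a m →
  ∀ b → Skew a m b → Star (Step a m) b (0 , m 0)
tail-connected tail (zero , j) (m≤j , j<a) = walk-left ≤-refl m≤j j<a
tail-connected (last _ _ rest) (suc i , j) (m≤j , j<a) =
  contradiction (rest i) (<⇒≢ (≤-<-trans m≤j j<a))
tail-connected {a = a} {m} (next m<a eq tail) (suc i , j) b∈ =
  path-nextRow (tail-connected tail (i , j) b∈)
  ◅◅ Star.reverse step-sym (walk-left ≤-refl m₁≤m₀ m₀<a₁)
  ◅◅ ((m₁≤m₀ , m₀<a₁) , (≤-refl , m<a) , up) ◅ ε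
  where
  m₀<a₁ : m 0 < a 1
  m₀<a₁ = ≤-reflexive eq
  m₁≤m₀ : m 1 ≤ m 0
  m₁≤m₀ = s≤s⁻¹ (subst (m 1 <_) (sym eq) (tail-head< tail))

strip-connected : ∀ {t a m} → Strip t a m →
  ∃[ c ] ∀ b → Skew a m b → Star (Step a m) b c
strip-connected {m = m} (here tail) = (0 , m 0) , tail-connected tail
strip-connected {a = a} {m} (there eq strip) =
  let c , connect = strip-connected strip in nextRow c , λ where
    (zero  , j) (m≤j , j<a) → contradiction eq (<⇒≢ (≤-<-trans m≤j j<a))
    (suc i , j) b∈ → path-nextRow (connect (i , j) b∈)

row-antitone : ∀ α → Antitone (row α)
row-antitone α = go (decreasing α)
  where
  go : ∀ {xs} → Linked _≥_ xs → Antitone (nth xs)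
  go []           k       = z≤n
  go [-]          zero    = z≤n
  go [-]          (suc k) = z≤n
  go (x≥y ∷ lnk) zero    = x≥y
  go (x≥y ∷ lnk) (suc k) = go lnk k

row-vanishes : ∀ α → VanishesFrom (ℓ α) (row α)
row-vanishes α = go (parts α)
  where
  go : ∀ xs → VanishesFrom (length xs) (nth xs)
  go []       k       _         = refl
  go (x ∷ xs) (suc k) (s≤s len) = go xs k len

strip⇒rimHook : ∀ {t α μ} → Strip t (row α) (row μ) → RimHook t α μ
strip⇒rimHook {t} {α} {μ} strip = record
  { contained = strip-≤ strip
  ; connected = λ b c b∈ c∈ →
      let _ , connect = strip-connected strip
      in connect b b∈ ◅◅ Star.reverse step-sym (connect c c∈)
  ; no2×2 = λ (i , j , (μ≤j , _) , (_ , j′<α) , (μ≤j″ , j<α) , (_ , sj<α)) →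
      <⇒≱ (≤-<-trans (s≤s μ≤j) sj<α)
        (strip-narrow strip i (≤-<-trans μ≤j (<-trans (n<1+n j) j′<α)) (≤-<-trans μ≤j″ j<α))
  ; size = subst (HasCardinality (Skew (row α) (row μ))) size≡t
      (skew-cardinality (ℓ α) (row α) (row μ) (row-vanishes α))
  }
  where
  size≡t : Σ< (ℓ α) (λ k → row α k ∸ row μ k) ≡ t
  size≡t = +-cancelʳ-≡ (Σ< (ℓ α) (row μ)) _ t
    (trans (Σ<-∸ (ℓ α) (strip-≤ strip)) (sym (strip-sum (ℓ α) strip (row-vanishes α))))

-- From rim hooks to strips

-- What connectedness contributes: rows `k` and `suc k` of the skew shape have a common column
-- whenever nonempty rows lie on both sides of the gap between them.
Crossing : (a m : ℕ → ℕ) → Set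
Crossing a m = ∀ i k j → i ≤ k → k < j → m i < a i → m j < a j → m k < a (suc k)

-- Steps change the row by at most one, so the path must at some point step down from row `k`; both
-- ends of that step lie in the shape and in the same column.
path-crosses : ∀ {a m b c k} → Star (Step a m) b c → proj₁ b ≤ k → k < proj₁ c → m k < a (suc k)
path-crosses ε b≤k k<c = contradiction k<c (≤⇒≯ b≤k)
path-crosses ((_ , _ , right) ◅ path) b≤k k<c = path-crosses path b≤k k<c
path-crosses ((_ , _ , left)  ◅ path) b≤k k<c = path-crosses path b≤k k<c
path-crosses ((_ , _ , up)    ◅ path) b≤k k<c = path-crosses path (<⇒≤ b≤k) k<c
path-crosses ((b∈ , c∈ , down) ◅ path) b≤k k<c with m≤n⇒m<n∨m≡n b≤k
... | inj₁ b<k  = path-crosses path b<k k<c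
... | inj₂ refl = ≤-<-trans (proj₁ b∈) (proj₂ c∈)

module _ {t : ℕ} where

  -- If row 1 is touched, crossing and narrowness bound `a 1` from both sides, which gives the
  -- equation of `next`. If not, the hook ends here. The size equation travels along, `x` growing by
  -- one per row, and turns into the length condition of `last`.
  crossing⇒tail : ∀ r x a m → VanishesFrom (suc r) a → Antitone a → (∀ k → m k ≤ a k) →
    Crossing a m → (∀ k → a (suc k) ≤ suc (m k)) → m 0 < a 0 →
    t + Σ< (suc r) m ≡ x + Σ< r (a ∘ suc) → Tail t x a m
  crossing⇒tail r x a m van anti m≤a cross narrow m<a sum≡ with m 1 <? a 1
  crossing⇒tail zero x a m van anti m≤a cross narrow m<a sum≡ | yes m₁<a₁ =
    contradiction (subst (m 1 <_) (van 1 ≤-refl) m₁<a₁) n≮0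
  crossing⇒tail (suc r) x a m van anti m≤a cross narrow m<a sum≡ | yes m₁<a₁ =
    next m<a eq (crossing⇒tail r (suc x) (a ∘ suc) (m ∘ suc) (vanishes-tail van)
      (anti ∘ suc) (m≤a ∘ suc) (λ i k j i≤k k<j → cross (suc i) (suc k) (suc j) (s≤s i≤k) (s≤s k<j))
      (narrow ∘ suc) m₁<a₁ (+-cancelˡ-≡ (m 0) _ _ (begin
        m 0 + (t + Σ< (suc r) (m ∘ suc))       ≡⟨ +-swapˡ (m 0) t _ ⟩
        t + (m 0 + Σ< (suc r) (m ∘ suc))       ≡⟨ sum≡ ⟩
        x + (a 1 + Σ< r (a ∘ suc ∘ suc))       ≡⟨ cong (λ z → x + (z + Σ< r (a ∘ suc ∘ suc))) (sym eq) ⟩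
        x + (suc (m 0) + Σ< r (a ∘ suc ∘ suc)) ≡⟨ shift x (m 0) _ ⟩
        m 0 + (suc x + Σ< r (a ∘ suc ∘ suc))   ∎)))
    where
    open ≡-Reasoning
    eq : suc (m 0) ≡ a 1
    eq = ≤-antisym (cross 0 0 1 z≤n z<s m<a m₁<a₁) (narrow 0)
    shift : ∀ a b c → a + (suc b + c) ≡ b + (suc a + c)
    shift = solve-∀
  crossing⇒tail r x a m van anti m≤a cross narrow m<a sum≡ | no m₁≮a₁ =
    last m<a (+-cancelʳ-≡ (Σ< r (a ∘ suc)) _ x (begin
      t + m 0 + Σ< r (a ∘ suc)   ≡⟨ +-assoc t (m 0) _ ⟩
      t + (m 0 + Σ< r (a ∘ suc)) ≡⟨ cong (λ z → t + (m 0 + z)) (Σ<-cong r (λ k _ → sym (rest k))) ⟩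
      t + (m 0 + Σ< r (m ∘ suc)) ≡⟨ sum≡ ⟩
      x + Σ< r (a ∘ suc)         ∎)) rest
    where
    open ≡-Reasoning
    rest : ∀ k → m (suc k) ≡ a (suc k)
    rest k with m≤n⇒m<n∨m≡n (m≤a (suc k))
    rest k       | inj₂ eq   = eq
    rest zero    | inj₁ m₁<a₁ = contradiction m₁<a₁ m₁≮a₁
    -- A touched row further down would force a column common to rows 1 and 2, hence
    -- `m 1 < a 2 ≤ a 1`, although row 1 is untouched.
    rest (suc k) | inj₁ m<a′ = contradiction
      (<-≤-trans (cross 0 1 (suc (suc k)) z≤n (s<s z<s) m<a m<a′) (anti 1)) m₁≮a₁

  crossing⇒strip : 0 < t → ∀ r a m → VanishesFrom r a → Antitone a → (∀ k → m k ≤ a k) →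
    Crossing a m → (∀ k → a (suc k) ≤ suc (m k)) →
    t + Σ< r m ≡ Σ< r a → Strip t a m
  crossing⇒strip t>0 zero a m van anti m≤a cross narrow sum≡ =
    contradiction (trans (sym (+-identityʳ t)) sum≡) (m<n⇒n≢0 t>0)
  crossing⇒strip t>0 (suc r) a m van anti m≤a cross narrow sum≡ with m≤n⇒m<n∨m≡n (m≤a 0)
  ... | inj₁ m<a = here (crossing⇒tail r (a 0) a m van anti m≤a cross narrow m<a sum≡)
  ... | inj₂ eq  = there eq (crossing⇒strip t>0 r (a ∘ suc) (m ∘ suc) (vanishes-tail van)
    (anti ∘ suc) (m≤a ∘ suc) (λ i k j i≤k k<j → cross (suc i) (suc k) (suc j) (s≤s i≤k) (s≤s k<j))
    (narrow ∘ suc) (+-cancelˡ-≡ (m 0) _ _ (trans (+-swapˡ (m 0) t _) (trans sum≡ (cong (_+ Σ< r (a ∘ suc)) (sym eq))))))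

rimHook⇒strip : ∀ {t α μ} → 0 < t → RimHook t α μ → Strip t (row α) (row μ)
rimHook⇒strip {t} {α} {μ} t>0 hook =
  crossing⇒strip t>0 (ℓ α) (row α) (row μ) (row-vanishes α) (row-antitone α) contained crossing narrow
    (trans (cong (_+ Σ< (ℓ α) (row μ))
        (cardinality-unique size (skew-cardinality (ℓ α) (row α) (row μ) (row-vanishes α))))
      (Σ<-∸ (ℓ α) contained))
  where
  open RimHook hook
  crossing : Crossing (row α) (row μ)
  crossing i k j i≤k k<j μi<αi μj<αj = path-crosses
    (connected (i , row μ i) (j , row μ j) (≤-refl , μi<αi) (≤-refl , μj<αj)) i≤k k<j
  narrow : ∀ k → row α (suc k) ≤ suc (row μ k)
  -- Otherwise columns `row μ k` and its successor belong to the shape in both rows, since the rows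
  -- of `α` and of `μ` weakly decrease.
  narrow k = ≮⇒≥ λ wide →
    no2×2 (k , row μ k ,
      (≤-refl , <-trans (n<1+n _) (<-≤-trans wide (row-antitone α k))) ,
      (n≤1+n _ , <-≤-trans wide (row-antitone α k)) ,
      (row-antitone μ k , <-trans (n<1+n _) wide) ,
      (≤-trans (row-antitone μ k) (n≤1+n _) , wide))

-- Beads

-- Positions of the r rightmost beads, in decreasing order, on the abacus
-- shifted by r.
betas : ℕ → (ℕ → ℕ) → List ℕ
betas zero    a = []
betas (suc r) a = a 0 + r ∷ betas r (a ∘ suc)

∈-betas⁻ : ∀ r {a z} → z ∈ betas r a → ∃[ k ] z + suc k ≡ a k + r
∈-betas⁻ (suc r) {a} (here refl) = 0 , shift (a 0) r
  where
  shift : ∀ a r → a + r + 1 ≡ a + suc r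
  shift = solve-∀
∈-betas⁻ (suc r) {a} {z} (there z∈) =
  let k , eq = ∈-betas⁻ r z∈
  in suc k , trans (+-suc z (suc k)) (trans (cong suc eq) (sym (+-suc (a (suc k)) r)))

-- The rows from `r` on are empty, so their beads have negative shifted positions; a bead at a
-- natural number comes from one of the listed rows.
∈-betas⁺ : ∀ r {a z k} → VanishesFrom r a → z + suc k ≡ a k + r → z ∈ betas r a
∈-betas⁺ zero    {a} {z} {k} van eq =
  contradiction (trans (sym (+-suc z k)) (trans eq (trans (+-identityʳ _) (van k z≤n)))) λ ()
∈-betas⁺ (suc r) {a} {z} {zero}  van eq = here (suc-injective (begin
  suc z       ≡⟨ +-comm z 1 ⟨
  z + 1       ≡⟨ eq ⟩
  a 0 + suc r ≡⟨ +-suc (a 0) r ⟩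
  suc (a 0 + r) ∎))
  where open ≡-Reasoning
∈-betas⁺ (suc r) {a} {z} {suc k} van eq = there (∈-betas⁺ r (vanishes-tail van)
  (suc-injective (trans (sym (+-suc z (suc k))) (trans eq (+-suc (a (suc k)) r)))))

betas-injective : ∀ r {a b} → betas r a ≡ betas r b → ∀ k → k < r → a k ≡ b k
betas-injective (suc r) eq zero    _         = +-cancelʳ-≡ r _ _ (proj₁ (∷-injective eq))
betas-injective (suc r) eq (suc k) (s≤s k<r) = betas-injective r (proj₂ (∷-injective eq)) k k<r

betas-cong : ∀ r {a b} → (∀ k → a k ≡ b k) → betas r a ≡ betas r b
betas-cong zero    a≡b = refl
betas-cong (suc r) a≡b = cong₂ _∷_ (cong (_+ r) (a≡b 0)) (betas-cong r (a≡b ∘ suc))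

data Descending : ℕ → List ℕ → Set where
  []  : ∀ {N} → Descending N []
  _∷_ : ∀ {N x xs} → x < N → Descending x xs → Descending N (x ∷ xs)

descending-mono : ∀ {M N xs} → M ≤ N → Descending M xs → Descending N xs
descending-mono M≤N []         = []
descending-mono M≤N (x< ∷ xs↘) = <-≤-trans x< M≤N ∷ xs↘

descending-∈ : ∀ {N xs z} → Descending N xs → z ∈ xs → z < N
descending-∈ (x< ∷ _)   (here refl) = x<
descending-∈ (x< ∷ xs↘) (there z∈)  = <-trans (descending-∈ xs↘ z∈) x<

betas-descending : ∀ r {a} → Antitone a → Descending (a 0 + r) (betas r a)
betas-descending zero    anti = []
betas-descending (suc r) {a} anti =
  ≤-reflexive (sym (+-suc (a 0) r)) ∷
  descending-mono (+-monoˡ-≤ r (anti 0)) (betas-descending r (anti ∘ suc))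

infixr 5 _∷ᵣ_
_∷ᵣ_ : ℕ → (ℕ → ℕ) → ℕ → ℕ
(x ∷ᵣ a) zero    = x
(x ∷ᵣ a) (suc k) = a k

∷ᵣ-antitone : ∀ {x a} → a 0 ≤ x → Antitone a → Antitone (x ∷ᵣ a)
∷ᵣ-antitone a≤x anti zero    = a≤x
∷ᵣ-antitone a≤x anti (suc k) = anti k

-- The bead to be moved stands at y + t = x + r, in row 0 or above; the recursion
-- passes the beads between it and y, each of which belongs to a row of the hook.
slide-tail : ∀ {t} r x y {a} → VanishesFrom (suc r) a → Antitone a →
  y < a 0 + r → y ∉ betas r (a ∘ suc) → y + t ≡ x + r →
  ∃[ m ] Tail t x a m × Antitone m
slide-tail {t} zero x y {a} van anti y<a y∉ eq =
  y ∷ᵣ a ∘ suc ,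
  last (subst (y <_) (+-identityʳ _) y<a) (trans (+-comm t y) (trans eq (+-identityʳ x))) (λ _ → refl) ,
  ∷ᵣ-antitone (subst (_≤ y) (sym (van 1 ≤-refl)) z≤n) (anti ∘ suc)
slide-tail {t} (suc r) x y {a} van anti y<a y∉ eq with <-cmp y (a 1 + r)
... | tri< y<a₁ _ _ =
  let m , tail , m-anti = slide-tail r (suc x) y (vanishes-tail van) (anti ∘ suc) y<a₁ (y∉ ∘ there)
        (trans eq (+-suc x r))
      instance a₁≢0 = >-nonZero (≤-<-trans z≤n (tail-head< tail))
  -- The row inherits the bead of the row below: `pred (a 1) + suc r` equals `a 1 + r`.
  in pred (a 1) ∷ᵣ m ,
     next (≤-trans (≤-reflexive (suc-pred (a 1))) (anti 0)) (suc-pred (a 1)) tail ,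
     ∷ᵣ-antitone (<⇒≤pred (tail-head< tail)) m-anti
... | tri≈ _ refl _ = contradiction (here refl) y∉
... | tri> _ _ a₁<y =
  -- The vacancy `y` lies between the beads of this row and the next, so the moved bead lands here
  -- and the hook ends.
  (y ∸ suc r) ∷ᵣ a ∘ suc ,
  last (+-cancelʳ-< (suc r) _ _ (subst (_< a 0 + suc r) (sym y-r+r) y<a))
    (+-cancelʳ-≡ (suc r) _ x (trans (+-assoc t _ (suc r)) (trans (cong (t +_) y-r+r) (trans (+-comm t y) eq))))
    (λ _ → refl) ,
  ∷ᵣ-antitone (+-cancelʳ-≤ (suc r) _ _ (≤-trans (≤-reflexive (+-suc (a 1) r)) (≤-trans a₁<y (≤-reflexive (sym y-r+r)))))
    (anti ∘ suc)
  where
  y-r+r : y ∸ suc r + suc r ≡ y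
  y-r+r = m∸n+n≡m (≤-trans (s≤s (m≤n+m r (a 1))) a₁<y)

slide : ∀ {t} → 0 < t → ∀ r y {a} → VanishesFrom r a → Antitone a →
  y + t ∈ betas r a → y ∉ betas r a → ∃[ m ] Strip t a m × Antitone m
slide t>0 (suc r) y {a} van anti (here eq) y∉ =
  let m , tail , m-anti = slide-tail r (a 0) y van anti
        (<-≤-trans (m<m+n y t>0) (≤-reflexive eq)) (y∉ ∘ there) eq
  in m , here tail , m-anti
slide t>0 (suc r) y {a} van anti (there y+t∈) y∉ =
  let m , strip , m-anti = slide t>0 r y (vanishes-tail van) (anti ∘ suc) y+t∈ (y∉ ∘ there)
  in a 0 ∷ᵣ m , there refl strip , ∷ᵣ-antitone (≤-trans (strip-≤ strip 0) (anti 0)) m-anti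

cons : ∀ x μ → 0 < x → row μ 0 ≤ x → Partition
cons x (mkPartition []       _   _)    x>0 _   = mkPartition (x ∷ []) [-] (x>0 ∷ [])
cons x (mkPartition (y ∷ ys) lnk ys>0) x>0 y≤x = mkPartition (x ∷ y ∷ ys) (y≤x ∷ lnk) (x>0 ∷ ys>0)

parts-cons : ∀ x μ x>0 μ≤x → parts (cons x μ x>0 μ≤x) ≡ x ∷ parts μ
parts-cons x (mkPartition []       _   _)    x>0 _   = refl
parts-cons x (mkPartition (y ∷ ys) lnk ys>0) x>0 y≤x = refl

fromRows : ∀ r f → Antitone f → VanishesFrom r f → ∃[ μ ] (∀ k → row μ k ≡ f k) × ℓ μ ≤ r
fromRows zero    f anti van = mkPartition [] [] [] , (λ k → sym (van k z≤n)) , z≤n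
fromRows (suc r) f anti van with f 0 in f₀
... | zero  = mkPartition [] [] [] , (λ k → sym (n≤0⇒n≡0 (f≤0 k))) , z≤n
  where
  f≤0 : ∀ k → f k ≤ 0
  f≤0 zero    = ≤-reflexive f₀
  f≤0 (suc k) = ≤-trans (anti k) (f≤0 k)
... | suc x =
  let μ , rows , len = fromRows r (f ∘ suc) (anti ∘ suc) (vanishes-tail van)
      μ≤x = ≤-trans (≤-reflexive (rows 0)) (≤-trans (anti 0) (≤-reflexive f₀))
      eq = parts-cons (suc x) μ z<s μ≤x
  in cons (suc x) μ z<s μ≤x ,
     (λ { zero → trans (cong (λ p → nth p 0) eq) (sym f₀)
        ; (suc k) → trans (cong (λ p → nth p (suc k)) eq) (rows k) }) ,
     ≤-trans (≤-reflexive (cong length eq)) (s≤s len)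

-- Pushing the beads to the left

Flush : ℕ → List ℕ → Set
Flush t bs = ∀ y → y + t ∈ bs → y ∈ bs

slidable? : ∀ t bs → Dec (∃[ y ] y + t ∈ bs × y ∉ bs)
slidable? t bs = map′
  (λ any → let x , x∈ , t≤x , x∸t∉ = find {P = Slides} any
           in x ∸ t , subst (_∈ bs) (sym (m∸n+n≡m t≤x)) x∈ , x∸t∉)
  (λ (y , y+t∈ , y∉) → lose y+t∈ (m≤n+m t y , subst (_∉ bs) (sym (m+n∸n≡m y t)) y∉))
  (any? (λ x → t ≤? x ×-dec ¬? (x ∸ t ∈? bs)) bs)
  where
  Slides : ℕ → Set
  Slides x = t ≤ x × x ∸ t ∉ bs

¬slidable⇒flush : ∀ {t bs} → ¬ (∃[ y ] y + t ∈ bs × y ∉ bs) → Flush t bs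
¬slidable⇒flush {bs = bs} ¬slidable y y+t∈ =
  decidable-stable (y ∈? bs) (λ y∉ → ¬slidable (y , y+t∈ , y∉))

slidable⇒rimHook : ∀ {t} → 0 < t → ∀ r α → VanishesFrom r (row α) →
  (∃[ y ] y + t ∈ betas r (row α) × y ∉ betas r (row α)) → ∃[ μ ] RimHook t α μ
slidable⇒rimHook t>0 r α van (y , y+t∈ , y∉) =
  let m , strip , m-anti = slide t>0 r y van (row-antitone α) y+t∈ y∉
      μ , rows , _ = fromRows r m m-anti
        (λ k r≤k → n≤0⇒n≡0 (≤-trans (strip-≤ strip k) (≤-reflexive (van k r≤k))))
  in μ , strip⇒rimHook (strip-cong (sym ∘ rows) strip)

⊆-vanishes : ∀ {r} α μ → μ ⊆ α → VanishesFrom r (row α) → VanishesFrom r (row μ)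
⊆-vanishes α μ μ⊆α van k r≤k = n≤0⇒n≡0 (≤-trans (μ⊆α k) (≤-reflexive (van k r≤k)))

-- Each removal takes away `t > 0` boxes, so the process stops. Its end is described by beads, the
-- form in which it is compared with `ρ`.
remove-rimHooks : ∀ {t} → 0 < t → ∀ r α → VanishesFrom r (row α) →
  ∃[ β ] Star (RimHook t) α β × Flush t (betas r (row β))
remove-rimHooks {t} t>0 r α van = go α van (<-wellFounded (Σ< r (row α)))
  where
  go : ∀ α → VanishesFrom r (row α) → Acc _<_ (Σ< r (row α)) →
    ∃[ β ] Star (RimHook t) α β × Flush t (betas r (row β))
  go α van (acc rec) with slidable? t (betas r (row α))
  ... | no ¬slidable = α , ε , ¬slidable⇒flush ¬slidable
  ... | yes slidable =
    let μ , hook = slidable⇒rimHook t>0 r α van slidable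
        smaller = <-≤-trans (m<n+m (Σ< r (row μ)) t>0)
          (≤-reflexive (strip-sum r (rimHook⇒strip t>0 hook) van))
        β , hooks , flush = go μ (⊆-vanishes α μ (RimHook.contained hook) van) (rec smaller)
    in β , hook ◅ hooks , flush

-- Residues

δ : ℕ → ℕ → ℕ
δ d i = if does (d ≟ i) then 1 else 0

δ-refl : ∀ d → δ d d ≡ 1
δ-refl d = cong (if_then 1 else 0) (dec-true (d ≟ d) refl)

δ-≢ : ∀ {d i} → d ≢ i → δ d i ≡ 0
δ-≢ {d} {i} d≢i = cong (if_then 1 else 0) (dec-false (d ≟ i) d≢i)

Σ<-zero : ∀ n {f : ℕ → ℕ} → (∀ k → f k ≡ 0) → Σ< n f ≡ 0
Σ<-zero zero    f≡0 = refl
Σ<-zero (suc n) f≡0 = cong₂ _+_ (f≡0 0) (Σ<-zero n (f≡0 ∘ suc))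

Σ<-δ : ∀ {d n} → d < n → Σ< n (δ d) ≡ 1
Σ<-δ {zero}  {suc n} _         = cong suc (Σ<-zero n (λ k → refl))
Σ<-δ {suc d} {suc n} (s≤s d<n) = Σ<-δ d<n

module _ (t : ℕ) .{{_ : NonZero t}} where

  residueCount : List ℕ → ℕ → ℕ
  residueCount bs i = sum (map (λ z → δ (z % t) i) bs)

  Σ-residueCount : ∀ bs → Σ< t (residueCount bs) ≡ length bs
  Σ-residueCount []       = Σ<-zero t (λ _ → refl)
  Σ-residueCount (x ∷ xs) = trans (Σ<-+ t (δ (x % t)) (residueCount xs))
    (cong₂ _+_ (Σ<-δ (m%n<n x t)) (Σ-residueCount xs))

  -- The moving bead stands at `x + r`, above the beads of the rows still to be treated. In `next`
  -- it changes places with the bead of row 1, which becomes the new bead of the top row;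
  -- `x + suc r ≡ suc x + r` explains the growth of the index. In `last` it drops by `t` and keeps
  -- its residue.
  tail-residueCount : ∀ r {x a m} → Tail t x a m → VanishesFrom (suc r) a → ∀ i →
    residueCount (x + r ∷ betas r (a ∘ suc)) i ≡ residueCount (betas (suc r) m) i
  tail-residueCount r {x} {a} {m} (last _ len rest) van i = cong₂ _+_
    (cong (λ d → δ d i) (begin
      (x + r) % t         ≡⟨ cong (λ z → (z + r) % t) len ⟨
      (t + m 0 + r) % t   ≡⟨ cong (_% t) (rearrange t (m 0) r) ⟩
      (m 0 + r + t) % t   ≡⟨ [m+n]%n≡m%n (m 0 + r) t ⟩
      (m 0 + r) % t       ∎))
    (cong (λ bs → residueCount bs i) (betas-cong r (sym ∘ rest)))
    where
    open ≡-Reasoning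
    rearrange : ∀ t m r → t + m + r ≡ m + r + t
    rearrange = solve-∀
  tail-residueCount zero    (next _ _ tail) van i =
    contradiction (subst (_ <_) (van 1 ≤-refl) (tail-head< tail)) n≮0
  tail-residueCount (suc r) {x} {a} {m} (next _ eq tail) van i = begin
    β (x + suc r) + (β (a 1 + r) + R)    ≡⟨ cong₂ (λ y z → β y + (β z + R)) (+-suc x r) (trans (cong (_+ r) (sym eq)) (sym (+-suc (m 0) r))) ⟩
    β (suc x + r) + (β (m 0 + suc r) + R) ≡⟨ +-swapˡ (β (suc x + r)) (β (m 0 + suc r)) R ⟩
    β (m 0 + suc r) + (β (suc x + r) + R) ≡⟨ cong (β (m 0 + suc r) +_) (tail-residueCount r tail (vanishes-tail van) i) ⟩
    β (m 0 + suc r) + residueCount (betas (suc r) (m ∘ suc)) i ∎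
    where
    open ≡-Reasoning
    β : ℕ → ℕ
    β z = δ (z % t) i
    R = residueCount (betas r (a ∘ suc ∘ suc)) i

  strip-residueCount : ∀ r {a m} → Strip t a m → VanishesFrom r a → ∀ i →
    residueCount (betas r a) i ≡ residueCount (betas r m) i
  strip-residueCount zero    strip            van i = refl
  strip-residueCount (suc r) (here tail)      van i = tail-residueCount r tail van i
  strip-residueCount (suc r) (there eq strip) van i =
    cong₂ _+_ (cong (λ z → δ ((z + r) % t) i) (sym eq)) (strip-residueCount r strip (vanishes-tail van) i)

  rimHooks-residueCount : 0 < t → ∀ r {α β} → Star (RimHook t) α β → VanishesFrom r (row α) → ∀ i →
    residueCount (betas r (row α)) i ≡ residueCount (betas r (row β)) i
  rimHooks-residueCount t>0 r ε van i = refl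
  rimHooks-residueCount t>0 r {α} (_◅_ {j = μ} hook hooks) van i = trans
    (strip-residueCount r (rimHook⇒strip t>0 hook) van i)
    (rimHooks-residueCount t>0 r hooks (⊆-vanishes α μ (RimHook.contained hook) van) i)

-- Binary words and their ones

ones< : ℕ → (ℕ → Bool) → ℕ
ones< n f = ones (tabulate {n = n} (f ∘ toℕ))

bit : Bool → ℕ
bit b = if b then 1 else 0

ones<-suc : ∀ n f → ones< (suc n) f ≡ bit (f 0) + ones< n (f ∘ suc)
ones<-suc n f with f 0
... | true  = refl
... | false = refl

-- Runners grow at the far end, whereas `tabulate` unfolds at the near end.
ones<-snoc : ∀ n f → ones< (suc n) f ≡ bit (f n) + ones< n f
ones<-snoc zero    f = ones<-suc 0 f
ones<-snoc (suc n) f = begin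
  ones< (suc (suc n)) f                         ≡⟨ ones<-suc (suc n) f ⟩
  bit (f 0) + ones< (suc n) (f ∘ suc)           ≡⟨ cong (bit (f 0) +_) (ones<-snoc n (f ∘ suc)) ⟩
  bit (f 0) + (bit (f (suc n)) + ones< n (f ∘ suc)) ≡⟨ +-swapˡ (bit (f 0)) (bit (f (suc n))) (ones< n (f ∘ suc)) ⟩
  bit (f (suc n)) + (bit (f 0) + ones< n (f ∘ suc)) ≡⟨ cong (bit (f (suc n)) +_) (ones<-suc n f) ⟨
  bit (f (suc n)) + ones< (suc n) f             ∎
  where open ≡-Reasoning

DownClosed : (ℕ → Bool) → Set
DownClosed f = ∀ k → f (suc k) ≡ true → f k ≡ true

downClosed-0 : ∀ {f} → DownClosed f → ∀ k → f k ≡ true → f 0 ≡ true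
downClosed-0 f↓ zero    fk = fk
downClosed-0 f↓ (suc k) fk = downClosed-0 f↓ k (f↓ k fk)

ones<-true : ∀ {n f} → DownClosed f → ∀ k → k < n → f k ≡ true → k < ones< n f
ones<-true {suc n} {f} f↓ zero    _         f0 rewrite ones<-suc n f | f0 = z<s
ones<-true {suc n} {f} f↓ (suc k) (s≤s k<n) fk
  rewrite ones<-suc n f | downClosed-0 f↓ (suc k) fk =
  s<s (ones<-true (f↓ ∘ suc) k k<n fk)

ones<-false : ∀ n {f} → DownClosed f → ∀ k → f k ≡ false → ones< n f ≤ k
ones<-false zero        f↓ k       fk = z≤n
ones<-false (suc n) {f} f↓ zero    f0 rewrite ones<-suc n f | f0 =
  ones<-false n (f↓ ∘ suc) 0 f1
  where
  f1 : f 1 ≡ false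
  f1 with f 1 in eq
  ... | false = refl
  ... | true  = contradiction (trans (sym f0) (f↓ 0 eq)) λ ()
ones<-false (suc n) {f} f↓ (suc k) fk rewrite ones<-suc n f =
  ≤-trans (+-monoˡ-≤ _ (bit≤1 (f 0))) (s≤s (ones<-false n (f↓ ∘ suc) k fk))
  where
  bit≤1 : ∀ b → bit b ≤ 1
  bit≤1 true  = ≤-refl
  bit≤1 false = z≤n

-- A down-closed word is a block of ones followed by zeros, so the number of ones is the place where
-- it switches.
downClosed-determined : ∀ {n f g} → DownClosed f → DownClosed g → ones< n f ≡ ones< n g →
  ∀ k → k < n → f k ≡ true → g k ≡ true
downClosed-determined {n} {f} {g} f↓ g↓ eq k k<n fk with g k in gk
... | true  = refl
... | false = contradiction (<-≤-trans (ones<-true f↓ k k<n fk) (≤-trans (≤-reflexive eq) (ones<-false n g↓ k gk))) (<-irrefl refl)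

-- Runners

module _ (t : ℕ) .{{_ : NonZero t}} where

  -- The number of positions p < N with p ≡ i modulo t, for i < t.
  runner : ℕ → ℕ → ℕ
  runner N i = (N + t ∸ 1 ∸ i) / t

  private
    quotient : ∀ d q → d < t → (d + q * t) / t ≡ q
    quotient d q d<t = begin
      (d + q * t) / t     ≡⟨ +-distrib-/-∣ʳ d (divides-refl q) ⟩
      d / t + q * t / t   ≡⟨ cong₂ _+_ (m<n⇒m/n≡0 d<t) (m*n/n≡m q t) ⟩
      q                   ∎
      where open ≡-Reasoning

    -- With `c` standing for `t - 1 - i`, the truncated subtractions disappear.
    runner-+ : ∀ N {i c} → suc (i + c) ≡ t → runner N i ≡ (N + c) / t
    runner-+ N {i} {c} eq = cong (_/ t) (begin
      N + t ∸ 1 ∸ i             ≡⟨ cong (λ z → N + z ∸ 1 ∸ i) eq ⟨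
      N + suc (i + c) ∸ 1 ∸ i   ≡⟨ cong (λ z → z ∸ 1 ∸ i) (+-suc N (i + c)) ⟩
      N + (i + c) ∸ i           ≡⟨ cong (_∸ i) (+-swapˡ N i c) ⟩
      i + (N + c) ∸ i           ≡⟨ m+n∸m≡n i (N + c) ⟩
      N + c                     ∎)
      where open ≡-Reasoning

    complement : ∀ {i} → i < t → ∃[ c ] suc (i + c) ≡ t
    complement {i} i<t = t ∸ suc i , m+[n∸m]≡n i<t

  runner-zero : ∀ {i} → i < t → runner 0 i ≡ 0
  runner-zero {i} i<t =
    let c , eq = complement i<t
    in trans (runner-+ 0 eq) (m<n⇒m/n≡0 (≤-trans (s≤s (m≤n+m c i)) (≤-reflexive eq)))

  runner-% : ∀ N → runner N (N % t) ≡ N / t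
  runner-% N =
    let c , eq = complement (m%n<n N t)
    in begin
    runner N (N % t)                  ≡⟨ runner-+ N eq ⟩
    (N + c) / t                       ≡⟨ cong (λ z → (z + c) / t) (m≡m%n+[m/n]*n N t) ⟩
    (N % t + N / t * t + c) / t       ≡⟨ cong (_/ t) (+-rightComm (N % t) _ c) ⟩
    (N % t + c + N / t * t) / t       ≡⟨ quotient _ (N / t) (≤-reflexive eq) ⟩
    N / t                             ∎
    where open ≡-Reasoning

  runner-suc-% : ∀ N → runner (suc N) (N % t) ≡ suc (runner N (N % t))
  runner-suc-% N =
    let c , eq = complement (m%n<n N t)
    in begin
    runner (suc N) (N % t)                  ≡⟨ runner-+ (suc N) eq ⟩
    suc (N + c) / t                         ≡⟨ cong (λ z → suc (z + c) / t) (m≡m%n+[m/n]*n N t) ⟩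
    suc (N % t + N / t * t + c) / t         ≡⟨ cong (λ z → suc z / t) (+-rightComm (N % t) _ c) ⟩
    (suc (N % t + c) + N / t * t) / t       ≡⟨ cong (λ z → (z + N / t * t) / t) eq ⟩
    (suc (N / t) * t) / t                   ≡⟨ m*n/n≡m (suc (N / t)) t ⟩
    suc (N / t)                             ≡⟨ cong suc (runner-% N) ⟨
    suc (runner N (N % t))                  ∎
    where open ≡-Reasoning

  private
    -- The successor reaches a multiple of `t` only if `d + c` is `t - 1`, that is, `d ≡ i`. For
    -- `d < i` both sums stay below `t`; for `d > i` both have already passed it, with remainders
    -- `suc e` and `e`.
    no-carry : ∀ {d i c} q → d < t → suc (i + c) ≡ t → d ≢ i →
      (suc (d + c) + q * t) / t ≡ (d + c + q * t) / t
    no-carry {d} {i} {c} q d<t eq d≢i with <-cmp d i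
    ... | tri< d<i _ _ =
      let d+c<t = ≤-trans (s≤s (+-monoˡ-≤ c d<i)) (≤-reflexive eq)
      in trans (quotient _ q d+c<t) (sym (quotient _ q (<⇒≤ d+c<t)))
    ... | tri≈ _ d≡i _ = contradiction d≡i d≢i
    ... | tri> _ _ i<d with m≤n⇒∃[o]m+o≡n i<d
    ...   | e , refl = begin
      (suc (suc i + e + c) + q * t) / t   ≡⟨ cong (_/ t) (carry₁ i e c (q * t)) ⟩
      (suc e + (suc (i + c) + q * t)) / t ≡⟨ cong (λ z → (suc e + (z + q * t)) / t) eq ⟩
      (suc e + suc q * t) / t             ≡⟨ quotient (suc e) (suc q) 1+e<t ⟩
      suc q                               ≡⟨ quotient e (suc q) (<-trans (n<1+n e) 1+e<t) ⟨
      (e + suc q * t) / t                 ≡⟨ cong (λ z → (e + (z + q * t)) / t) eq ⟨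
      (e + (suc (i + c) + q * t)) / t     ≡⟨ cong (_/ t) (carry₂ i e c (q * t)) ⟩
      (suc i + e + c + q * t) / t         ∎
      where
      open ≡-Reasoning
      1+e<t : suc e < t
      1+e<t = ≤-<-trans (s≤s (m≤n+m e i)) d<t
      carry₁ : ∀ i e c x → suc (suc i + e + c) + x ≡ suc e + (suc (i + c) + x)
      carry₁ = solve-∀
      carry₂ : ∀ i e c x → e + (suc (i + c) + x) ≡ suc i + e + c + x
      carry₂ = solve-∀

  runner-suc-≢ : ∀ N {i} → i < t → N % t ≢ i → runner (suc N) i ≡ runner N i
  runner-suc-≢ N {i} i<t d≢i =
    let c , eq = complement i<t
        d = N % t
        q = N / t
        N+c≡ = trans (cong (_+ c) (m≡m%n+[m/n]*n N t)) (+-rightComm d (q * t) c)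
    in begin
    runner (suc N) i            ≡⟨ runner-+ (suc N) eq ⟩
    suc (N + c) / t             ≡⟨ cong (λ z → suc z / t) N+c≡ ⟩
    (suc (d + c) + q * t) / t   ≡⟨ no-carry q (m%n<n N t) eq d≢i ⟩
    (d + c + q * t) / t         ≡⟨ cong (_/ t) N+c≡ ⟨
    (N + c) / t                 ≡⟨ runner-+ N eq ⟨
    runner N i                  ∎
    where open ≡-Reasoning

-- Descending lists as sets of positions

descending-suc⁻ : ∀ {N bs} → Descending (suc N) bs →
  Descending N bs ⊎ ∃[ xs ] Descending N xs × bs ≡ N ∷ xs
descending-suc⁻ [] = inj₁ []
descending-suc⁻ (x<1+N ∷ xs↘) with m≤n⇒m<n∨m≡n (s≤s⁻¹ x<1+N)
... | inj₁ x<N  = inj₁ (x<N ∷ xs↘)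
... | inj₂ refl = inj₂ (_ , xs↘ , refl)

∈-∷⁻ : ∀ {z x : ℕ} {xs} → z < x → z ∈ x ∷ xs → z ∈ xs
∈-∷⁻ z<x (here refl) = contradiction z<x (<-irrefl refl)
∈-∷⁻ z<x (there z∈)  = z∈

descending-ext : ∀ N {bs cs} → Descending N bs → Descending N cs →
  (∀ z → z < N → z ∈ bs ⇔ z ∈ cs) → bs ≡ cs
descending-ext zero    []  []  _ = refl
descending-ext (suc N) bs↘ cs↘ bs⇔cs with descending-suc⁻ bs↘ | descending-suc⁻ cs↘
... | inj₁ bs↘′ | inj₁ cs↘′ =
  descending-ext N bs↘′ cs↘′ (λ z z<N → bs⇔cs z (m<n⇒m<1+n z<N))
... | inj₁ bs↘′ | inj₂ (_ , _ , refl) =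
  contradiction (descending-∈ bs↘′ (from (bs⇔cs N ≤-refl) (here refl))) (<-irrefl refl)
... | inj₂ (_ , _ , refl) | inj₁ cs↘′ =
  contradiction (descending-∈ cs↘′ (to (bs⇔cs N ≤-refl) (here refl))) (<-irrefl refl)
... | inj₂ (_ , xs↘ , refl) | inj₂ (_ , ys↘ , refl) =
  cong (N ∷_) (descending-ext N xs↘ ys↘ (λ z z<N → mk⇔
    (λ z∈ → ∈-∷⁻ z<N (to (bs⇔cs z (m<n⇒m<1+n z<N)) (there z∈)))
    (λ z∈ → ∈-∷⁻ z<N (from (bs⇔cs z (m<n⇒m<1+n z<N)) (there z∈)))))

does-⇔ : ∀ {P : Set} (P? : Dec P) → does P? ≡ true ⇔ P
does-⇔ (yes p) = mk⇔ (λ _ → p) (λ _ → refl)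
does-⇔ (no ¬p) = mk⇔ (λ ()) (λ p → contradiction p ¬p)

-- Finite products

Π< : ℕ → (ℕ → ℕ) → ℕ
Π< n f = product (applyUpTo f n)

Π<-cong : ∀ n {f g : ℕ → ℕ} → (∀ k → k < n → f k ≡ g k) → Π< n f ≡ Π< n g
Π<-cong zero    f≡g = refl
Π<-cong (suc n) f≡g = cong₂ _*_ (f≡g 0 z<s) (Π<-cong n (λ k k<n → f≡g (suc k) (s<s k<n)))

Π<-one : ∀ n {f : ℕ → ℕ} → (∀ k → k < n → f k ≡ 1) → Π< n f ≡ 1
Π<-one zero    f≡1 = refl
Π<-one (suc n) f≡1 = cong₂ _*_ (f≡1 0 z<s) (Π<-one n (λ k k<n → f≡1 (suc k) (s<s k<n)))

Π<-zero : ∀ n {f : ℕ → ℕ} j → j < n → f j ≡ 0 → Π< n f ≡ 0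
Π<-zero (suc n) {f} zero    _         fj = cong (_* Π< n (f ∘ suc)) fj
Π<-zero (suc n) {f} (suc j) (s≤s j<n) fj =
  trans (cong (f 0 *_) (Π<-zero n j j<n fj)) (*-zeroʳ (f 0))

-- Additivity of the product in its `j`-th factor, which lifts Pascal's rule from one runner to all
-- of them.
Π<-additive : ∀ n {f g h : ℕ → ℕ} j → j < n → f j ≡ g j + h j →
  (∀ k → k < n → j ≢ k → f k ≡ g k × f k ≡ h k) → Π< n f ≡ Π< n g + Π< n h
Π<-additive (suc n) {f} {g} {h} zero _ fj rest = begin
  f 0 * Π< n (f ∘ suc)                            ≡⟨ cong (_* Π< n (f ∘ suc)) fj ⟩
  (g 0 + h 0) * Π< n (f ∘ suc)                    ≡⟨ *-distribʳ-+ _ (g 0) (h 0) ⟩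
  g 0 * Π< n (f ∘ suc) + h 0 * Π< n (f ∘ suc)     ≡⟨ cong₂ (λ x y → g 0 * x + h 0 * y)
    (Π<-cong n (λ k k<n → proj₁ (rest (suc k) (s<s k<n) λ ())))
    (Π<-cong n (λ k k<n → proj₂ (rest (suc k) (s<s k<n) λ ()))) ⟩
  g 0 * Π< n (g ∘ suc) + h 0 * Π< n (h ∘ suc)     ∎
  where open ≡-Reasoning
Π<-additive (suc n) {f} {g} {h} (suc j) (s≤s j<n) fj rest = begin
  f 0 * Π< n (f ∘ suc)                            ≡⟨ cong (f 0 *_) (Π<-additive n j j<n fj
    (λ k k<n j≢k → rest (suc k) (s<s k<n) (j≢k ∘ suc-injective))) ⟩
  f 0 * (Π< n (g ∘ suc) + Π< n (h ∘ suc))         ≡⟨ *-distribˡ-+ (f 0) _ _ ⟩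
  f 0 * Π< n (g ∘ suc) + f 0 * Π< n (h ∘ suc)     ≡⟨ cong₂ (λ x y → x * Π< n (g ∘ suc) + y * Π< n (h ∘ suc))
    (proj₁ (rest 0 z<s λ ())) (proj₂ (rest 0 z<s λ ())) ⟩
  g 0 * Π< n (g ∘ suc) + h 0 * Π< n (h ∘ suc)     ∎
  where open ≡-Reasoning

-- Configurations with prescribed runner counts

module _ (t : ℕ) .{{_ : NonZero t}} where

  %+*/ : ∀ N → N % t + t * (N / t) ≡ N
  %+*/ N = trans (cong (N % t +_) (*-comm t (N / t))) (sym (m≡m%n+[m/n]*n N t))

  onRunner : (ℕ → Bool) → ℕ → ℕ → Bool
  onRunner g i k = g (i + t * k)

  -- The new position `N` is place `N / t` on runner `N % t`, just past its former end; the other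
  -- runners do not change.
  ones<-runner-suc : ∀ (g : ℕ → Bool) N {i} → i < t →
    ones< (runner t (suc N) i) (onRunner g i) ≡
    (if g N then δ (N % t) i else 0) + ones< (runner t N i) (onRunner g i)
  ones<-runner-suc g N {i} i<t with N % t ≟ i
  ... | yes refl = begin
    ones< (runner t (suc N) (N % t)) f                  ≡⟨ cong (λ n → ones< n f) (runner-suc-% t N) ⟩
    ones< (suc (runner t N (N % t))) f                  ≡⟨ ones<-snoc (runner t N (N % t)) f ⟩
    bit (f (runner t N (N % t))) + _                    ≡⟨ cong (λ k → bit (g k) + ones< (runner t N (N % t)) f)
      (trans (cong (λ q → N % t + t * q) (runner-% t N)) (%+*/ N)) ⟩
    bit (g N) + _                                       ≡⟨ cong (λ x → (if g N then x else 0) + ones< (runner t N (N % t)) f) (sym (δ-refl (N % t))) ⟩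
    (if g N then δ (N % t) (N % t) else 0) + ones< (runner t N (N % t)) f ∎
    where
    open ≡-Reasoning
    f : ℕ → Bool
    f = onRunner g (N % t)
  ... | no d≢i = begin
    ones< (runner t (suc N) i) f    ≡⟨ cong (λ n → ones< n f) (runner-suc-≢ t N i<t d≢i) ⟩
    ones< (runner t N i) f          ≡⟨ cong (_+ ones< (runner t N i) f) (if-same (g N)) ⟨
    (if g N then 0 else 0) + ones< (runner t N i) f             ≡⟨ cong (λ x → (if g N then x else 0) + ones< (runner t N i) f) (δ-≢ d≢i) ⟨
    (if g N then δ (N % t) i else 0) + ones< (runner t N i) f ∎
    where
    open ≡-Reasoning
    f : ℕ → Bool
    f = onRunner g i
    if-same : ∀ b → (if b then 0 else 0) ≡ 0
    if-same true  = refl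
    if-same false = refl

  residueCount-ones : ∀ N (g : ℕ → Bool) {bs} → Descending N bs →
    (∀ z → z < N → g z ≡ true ⇔ z ∈ bs) → ∀ i → i < t →
    residueCount t bs i ≡ ones< (runner t N i) (onRunner g i)
  residueCount-ones zero    g [] g⇔ i i<t = sym (cong (λ n → ones< n (onRunner g i)) (runner-zero t i<t))
  residueCount-ones (suc N) g {bs} bs↘ g⇔ i i<t with descending-suc⁻ bs↘
  ... | inj₁ bs↘′ = begin
    residueCount t bs i                                  ≡⟨ residueCount-ones N g bs↘′ (λ z z<N → g⇔ z (m<n⇒m<1+n z<N)) i i<t ⟩
    ones< (runner t N i) (onRunner g i)                  ≡⟨ cong added gN ⟨
    added (g N)                                          ≡⟨ ones<-runner-suc g N i<t ⟨
    ones< (runner t (suc N) i) (onRunner g i)            ∎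
    where
    open ≡-Reasoning
    added : Bool → ℕ
    added b = (if b then δ (N % t) i else 0) + ones< (runner t N i) (onRunner g i)
    gN : g N ≡ false
    gN with g N in eq
    ... | false = refl
    ... | true  = contradiction (descending-∈ bs↘′ (to (g⇔ N ≤-refl) eq)) (<-irrefl refl)
  ... | inj₂ (xs , xs↘ , refl) = begin
    δ (N % t) i + residueCount t xs i                    ≡⟨ cong (δ (N % t) i +_) (residueCount-ones N g xs↘ (λ z z<N → mk⇔
        (λ gz → ∈-∷⁻ z<N (to (g⇔ z (m<n⇒m<1+n z<N)) gz))
        (λ z∈ → from (g⇔ z (m<n⇒m<1+n z<N)) (there z∈))) i i<t) ⟩
    δ (N % t) i + ones< (runner t N i) (onRunner g i)    ≡⟨ cong added (from (g⇔ N ≤-refl) (here refl)) ⟨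
    added (g N)                                          ≡⟨ ones<-runner-suc g N i<t ⟨
    ones< (runner t (suc N) i) (onRunner g i)            ∎
    where
    open ≡-Reasoning
    added : Bool → ℕ
    added b = (if b then δ (N % t) i else 0) + ones< (runner t N i) (onRunner g i)

  -- Flushness makes the word on each runner down-closed, so its number of ones determines it; `z`
  -- is read off at place `z / t` of runner `z % t`.
  flush-determined : ∀ N {bs cs} → Descending N bs → Descending N cs → Flush t bs → Flush t cs →
    (∀ i → i < t → residueCount t bs i ≡ residueCount t cs i) → bs ≡ cs
  flush-determined N bs↘ cs↘ bs-flush cs-flush counts = descending-ext N bs↘ cs↘ (λ z z<N → mk⇔
    (included bs↘ cs↘ bs-flush cs-flush counts z)
    (included cs↘ bs↘ cs-flush bs-flush (λ i i<t → sym (counts i i<t)) z))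
    where
    indicator : List ℕ → ℕ → Bool
    indicator bs z = does (z ∈? bs)
    downClosed : ∀ bs i → Flush t bs → DownClosed (onRunner (indicator bs) i)
    downClosed bs i flush k eq = from (does-⇔ (i + t * k ∈? bs))
      (flush _ (subst (_∈ bs) (next≡ i t k) (to (does-⇔ (i + t * suc k ∈? bs)) eq)))
      where
      next≡ : ∀ i t k → i + t * suc k ≡ i + t * k + t
      next≡ = solve-∀
    included : ∀ {bs cs} → Descending N bs → Descending N cs → Flush t bs → Flush t cs →
      (∀ i → i < t → residueCount t bs i ≡ residueCount t cs i) → ∀ z → z ∈ bs → z ∈ cs
    included {bs} {cs} bs↘ cs↘ bs-flush cs-flush counts z z∈ = to (does-⇔ (z ∈? cs))
      (subst (λ y → indicator cs y ≡ true) (%+*/ z)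
        (downClosed-determined (downClosed bs (z % t) bs-flush) (downClosed cs (z % t) cs-flush)
          (trans (sym (count bs↘)) (trans (counts (z % t) z%t<t) (count cs↘)))
          (z / t) z/t<
          (subst (λ y → indicator bs y ≡ true) (sym (%+*/ z)) (from (does-⇔ (z ∈? bs)) z∈))))
      where
      z%t<t = m%n<n z t
      count : ∀ {xs} → Descending N xs →
        residueCount t xs (z % t) ≡ ones< (runner t N (z % t)) (onRunner (indicator xs) (z % t))
      count {xs} xs↘ = residueCount-ones N (indicator xs) xs↘ (λ y _ → does-⇔ (y ∈? xs)) (z % t) z%t<t
      -- Runner `z % t` already contains place `z / t` when there are `suc z` positions, and runners
      -- only grow with the number of positions.
      z/t< : z / t < runner t N (z % t)
      z/t< = begin-strict
        z / t                           ≡⟨ runner-% t z ⟨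
        runner t z (z % t)              <⟨ ≤-refl ⟩
        suc (runner t z (z % t))        ≡⟨ runner-suc-% t z ⟨
        runner t (suc z) (z % t)        ≤⟨ /-monoˡ-≤ t (∸-monoˡ-≤ (z % t) (∸-monoˡ-≤ 1 (+-monoˡ-≤ t (descending-∈ bs↘ z∈)))) ⟩
        runner t N (z % t)              ∎
        where open ≤-Reasoning

  Configuration : ℕ → (ℕ → ℕ) → List ℕ → Set
  Configuration N a bs = Descending N bs × (∀ i → i < t → residueCount t bs i ≡ a i)

  -- The counts `a` are arbitrary because a bead on the last position lowers one of them in the
  -- recursion.
  configuration-cardinality : ∀ N a →
    HasCardinality (Configuration N a) (Π< t (λ i → runner t N i C a i))
  configuration-cardinality zero a with anyUpTo? (λ i → ¬? (a i ≟ 0)) t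
  ... | yes (i , i<t , ai≢0) = subst (HasCardinality _) (sym (Π<-zero t i i<t vanishing))
    (cardinality-∅ λ { [] ([] , counts) → ai≢0 (sym (counts i i<t)) })
    where
    vanishing : runner t 0 i C a i ≡ 0
    vanishing = k>n⇒nCk≡0 (subst (_< a i) (sym (runner-zero t i<t)) (n≢0⇒n>0 ai≢0))
  ... | no ¬any = subst (HasCardinality _) (sym (Π<-one t (λ i i<t → cong (runner t 0 i C_) (a≡0 i i<t))))
    ([] ∷ [] , [] ∷ [] ,
     (λ bs → mk⇔ (λ { (here refl) → [] , (λ i i<t → sym (a≡0 i i<t)) })
                 (λ { ([] , _) → here refl })) ,
     refl)
    where
    a≡0 : ∀ i → i < t → a i ≡ 0
    a≡0 i i<t = decidable-stable (a i ≟ 0) (λ ai≢0 → ¬any (i , i<t , ai≢0))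
  configuration-cardinality (suc N) a with a (N % t) in ad
  -- With count zero on its runner, position `N` stays vacant, and lengthening that runner leaves
  -- its binomial coefficient at one.
  ... | zero = subst (HasCardinality _) (Π<-cong t same)
    (cardinality-⇔ drop (configuration-cardinality N a))
    where
    same : ∀ i → i < t → runner t N i C a i ≡ runner t (suc N) i C a i
    same i i<t with N % t ≟ i
    ... | yes refl = trans (cong (runner t N i C_) ad) (sym (cong (runner t (suc N) i C_) ad))
    ... | no d≢i   = cong (_C a i) (sym (runner-suc-≢ t N i<t d≢i))
    drop : ∀ bs → Configuration N a bs ⇔ Configuration (suc N) a bs
    drop bs = mk⇔ (λ (bs↘ , counts) → descending-mono (n≤1+n N) bs↘ , counts) back
      where
      back : Configuration (suc N) a bs → Configuration N a bs
      back (bs↘ , counts) with descending-suc⁻ bs↘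
      ... | inj₁ bs↘′ = bs↘′ , counts
      ... | inj₂ (xs , _ , refl) = contradiction
        (trans (cong (_+ residueCount t xs (N % t)) (sym (δ-refl (N % t)))) (trans (counts (N % t) (m%n<n N t)) ad)) λ ()
  -- The two summands of Pascal's rule: `N` vacant, with counts `a`, or `N` occupied, with counts
  -- `a′`.
  ... | suc c = subst (HasCardinality _) (sym (Π<-additive t (N % t) (m%n<n N t) pascal elsewhere))
    (cardinality-⇔ split
      (cardinality-⊎ (λ { _ (bs↘ , _) (_ , _ , refl) → <-irrefl refl (descending-∈ bs↘ (here refl)) })
        (configuration-cardinality N a)
        (cardinality-image (N ∷_) ∷-injectiveʳ (configuration-cardinality N a′))))
    where
    a′ : ℕ → ℕ
    a′ i = a i ∸ δ (N % t) i
    a′d : a′ (N % t) ≡ c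
    a′d = cong₂ _∸_ ad (δ-refl (N % t))
    pascal : runner t (suc N) (N % t) C a (N % t) ≡
      runner t N (N % t) C a (N % t) + runner t N (N % t) C a′ (N % t)
    pascal = begin
      runner t (suc N) (N % t) C a (N % t)      ≡⟨ cong₂ _C_ (runner-suc-% t N) ad ⟩
      suc R C suc c                             ≡⟨ nCk+nC[k+1]≡[n+1]C[k+1] R c ⟨
      R C c + R C suc c                         ≡⟨ +-comm (R C c) (R C suc c) ⟩
      R C suc c + R C c                         ≡⟨ cong₂ (λ x y → R C x + R C y) (sym ad) (sym a′d) ⟩
      R C a (N % t) + R C a′ (N % t)            ∎
      where
      open ≡-Reasoning
      R = runner t N (N % t)
    elsewhere : ∀ i → i < t → N % t ≢ i →
      runner t (suc N) i C a i ≡ runner t N i C a i × runner t (suc N) i C a i ≡ runner t N i C a′ i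
    elsewhere i i<t d≢i =
      cong (_C a i) (runner-suc-≢ t N i<t d≢i) ,
      cong₂ _C_ (runner-suc-≢ t N i<t d≢i) (sym (cong (a i ∸_) (δ-≢ d≢i)))
    δ≤a : ∀ i → δ (N % t) i ≤ a i
    δ≤a i with N % t ≟ i
    ... | yes refl = ≤-trans (≤-reflexive (δ-refl (N % t))) (subst (1 ≤_) (sym ad) (s≤s z≤n))
    ... | no d≢i   = ≤-trans (≤-reflexive (δ-≢ d≢i)) z≤n
    split : ∀ bs →
      (Configuration N a bs ⊎ (∃[ xs ] Configuration N a′ xs × bs ≡ N ∷ xs)) ⇔ Configuration (suc N) a bs
    split bs = mk⇔
      (λ { (inj₁ (bs↘ , counts)) → descending-mono (n≤1+n N) bs↘ , counts
         ; (inj₂ (xs , (xs↘ , counts) , refl)) → ≤-refl ∷ xs↘ ,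
             (λ i i<t → trans (cong (δ (N % t) i +_) (counts i i<t)) (m+[n∸m]≡n (δ≤a i))) })
      back
      where
      back : Configuration (suc N) a bs → Configuration N a bs ⊎ (∃[ xs ] Configuration N a′ xs × bs ≡ N ∷ xs)
      back (bs↘ , counts) with descending-suc⁻ bs↘
      ... | inj₁ bs↘′ = inj₁ (bs↘′ , counts)
      ... | inj₂ (xs , xs↘ , refl) = inj₂ (xs , (xs↘ , λ i i<t →
        trans (sym (m+n∸m≡n (δ (N % t) i) _)) (cong (_∸ δ (N % t) i) (counts i i<t))) , refl)

-- Partitions and their beads

-- Inverse of `betas`: a row is as long as the number of vacancies to the left of its bead, that is,
-- its position less the number of smaller beads. Trailing zeros may occur.
rowLengths : List ℕ → List ℕ
rowLengths []       = []
rowLengths (x ∷ xs) = x ∸ length xs ∷ rowLengths xs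

descending-length : ∀ {N xs} → Descending N xs → length xs ≤ N
descending-length []         = z≤n
descending-length (x< ∷ xs↘) = ≤-trans (s≤s (descending-length xs↘)) x<

betas-rowLengths : ∀ {N xs} → Descending N xs → betas (length xs) (nth (rowLengths xs)) ≡ xs
betas-rowLengths []         = refl
betas-rowLengths (x< ∷ xs↘) =
  cong₂ _∷_ (m∸n+n≡m (descending-length xs↘)) (betas-rowLengths xs↘)

rowLengths-antitone : ∀ {N xs} → Descending N xs → Antitone (nth (rowLengths xs))
rowLengths-antitone []              k       = z≤n
rowLengths-antitone (_ ∷ [])        zero    = z≤n
rowLengths-antitone (_ ∷ (_∷_ {x = y} {xs = ys} y<x ys↘)) zero = m+n≤o⇒m≤o∸n (y ∸ length ys) (begin
  y ∸ length ys + suc (length ys)   ≡⟨ +-suc (y ∸ length ys) (length ys) ⟩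
  suc (y ∸ length ys + length ys)   ≡⟨ cong suc (m∸n+n≡m (descending-length ys↘)) ⟩
  suc y                             ≤⟨ y<x ⟩
  _                                 ∎)
  where open ≤-Reasoning
rowLengths-antitone (_ ∷ xs↘)       (suc k) = rowLengths-antitone xs↘ k

rowLengths-vanishes : ∀ xs → VanishesFrom (length xs) (nth (rowLengths xs))
rowLengths-vanishes []       k       _         = refl
rowLengths-vanishes (x ∷ xs) (suc k) (s≤s len) = rowLengths-vanishes xs k len

rowLengths-bound : ∀ {N xs} → Descending N xs → nth (rowLengths xs) 0 + length xs ≤ N
rowLengths-bound []         = z≤n
rowLengths-bound {xs = x ∷ xs} (x< ∷ xs↘) = ≤-trans
  (≤-reflexive (trans (+-suc _ (length xs)) (cong suc (m∸n+n≡m (descending-length xs↘))))) x<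

betas-surjective : ∀ {r s xs} → Descending (r + s) xs → length xs ≡ r →
  ∃[ α ] α ∈𝒫[ r , s ] × betas r (row α) ≡ xs
betas-surjective {s = s} {xs} xs↘ refl =
  let α , rows , len = fromRows (length xs) (nth (rowLengths xs)) (rowLengths-antitone xs↘) (rowLengths-vanishes xs)
  in α ,
     (len , subst (_≤ s) (sym (rows 0)) (+-cancelʳ-≤ (length xs) _ s
       (≤-trans (rowLengths-bound xs↘) (≤-reflexive (+-comm (length xs) s))))) ,
     trans (betas-cong (length xs) rows) (betas-rowLengths xs↘)

parts-ext : ∀ {xs ys} → All (0 <_) xs → All (0 <_) ys → (∀ k → nth xs k ≡ nth ys k) → xs ≡ ys
parts-ext []         []         eq = refl
parts-ext []         (y>0 ∷ _)  eq = contradiction (eq 0) (<⇒≢ y>0)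
parts-ext (x>0 ∷ _)  []         eq = contradiction (sym (eq 0)) (<⇒≢ x>0)
parts-ext (_ ∷ xs>0) (_ ∷ ys>0) eq = cong₂ _∷_ (eq 0) (parts-ext xs>0 ys>0 (eq ∘ suc))

partition-ext : ∀ {α β} → (∀ k → row α k ≡ row β k) → α ≡ β
partition-ext {mkPartition xs xs↘ xs>0} {mkPartition ys ys↘ ys>0} eq with parts-ext xs>0 ys>0 eq
... | refl = cong₂ (mkPartition xs) (Linked.irrelevant ≤-irrelevant xs↘ ys↘) (All.irrelevant ≤-irrelevant xs>0 ys>0)

∈𝒫-vanishes : ∀ {r s} α → α ∈𝒫[ r , s ] → VanishesFrom r (row α)
∈𝒫-vanishes α (len , _) k r≤k = row-vanishes α k (≤-trans len r≤k)

width-descending : ∀ {r s} α → row α 0 ≤ s → Descending (r + s) (betas r (row α))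
width-descending {r} {s} α width = descending-mono
  (≤-trans (+-monoˡ-≤ r width) (≤-reflexive (+-comm s r))) (betas-descending r (row-antitone α))

betas-determine : ∀ {r} α β → VanishesFrom r (row α) → VanishesFrom r (row β) →
  betas r (row α) ≡ betas r (row β) → α ≡ β
betas-determine {r} α β α-van β-van eq = partition-ext same
  where
  same : ∀ k → row α k ≡ row β k
  same k with k <? r
  ... | yes k<r = betas-injective r eq k k<r
  ... | no k≮r  = trans (α-van k (≮⇒≥ k≮r)) (sym (β-van k (≮⇒≥ k≮r)))

length-betas : ∀ r a → length (betas r a) ≡ r
length-betas zero    a = refl
length-betas (suc r) a = cong suc (length-betas r (a ∘ suc))

bead⇔ : ∀ r α z → VanishesFrom r (row α) → Bead α (ℤ.- pos r ℤ.+ pos z) ⇔ z ∈ betas r (row α)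
bead⇔ r α z van = mk⇔
  (λ (k , eq) → ∈-betas⁺ r van (ℤ.+-injective (cross-add (pos r) (pos z) (pos (row α k)) (pos (suc k)) eq)))
  (λ z∈ → let k , eq = ∈-betas⁻ r z∈
          in k , split-difference (pos r) (pos z) (pos (row α k)) (pos (suc k)) (cong pos eq))
  where
  cross-add : ∀ r z a k → ℤ.- r ℤ.+ z ≡ a ℤ.- k → z ℤ.+ k ≡ a ℤ.+ r
  cross-add r z a k eq = begin
    z ℤ.+ k                             ≡⟨ expand r z k ⟩
    (ℤ.- r ℤ.+ z) ℤ.+ (r ℤ.+ k)         ≡⟨ cong (ℤ._+ (r ℤ.+ k)) eq ⟩
    (a ℤ.- k) ℤ.+ (r ℤ.+ k)             ≡⟨ collect a k r ⟩
    a ℤ.+ r                             ∎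
    where
    open ≡-Reasoning
    expand : ∀ r z k → z ℤ.+ k ≡ (ℤ.- r ℤ.+ z) ℤ.+ (r ℤ.+ k)
    expand = ℤ-Solver.solve-∀
    collect : ∀ a k r → (a ℤ.- k) ℤ.+ (r ℤ.+ k) ≡ a ℤ.+ r
    collect = ℤ-Solver.solve-∀
  split-difference : ∀ r z a k → z ℤ.+ k ≡ a ℤ.+ r → ℤ.- r ℤ.+ z ≡ a ℤ.- k
  split-difference r z a k eq = begin
    ℤ.- r ℤ.+ z                         ≡⟨ expand r z k ⟩
    (z ℤ.+ k) ℤ.- (r ℤ.+ k)             ≡⟨ cong (ℤ._- (r ℤ.+ k)) eq ⟩
    (a ℤ.+ r) ℤ.- (r ℤ.+ k)             ≡⟨ collect a k r ⟩
    a ℤ.- k                             ∎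
    where
    open ≡-Reasoning
    expand : ∀ r z k → ℤ.- r ℤ.+ z ≡ (z ℤ.+ k) ℤ.- (r ℤ.+ k)
    expand = ℤ-Solver.solve-∀
    collect : ∀ a k r → (a ℤ.+ r) ℤ.- (r ℤ.+ k) ≡ a ℤ.- k
    collect = ℤ-Solver.solve-∀

-- Entry `k` of the word `v` for `i` sits at shifted position `i + t * k`, and its length
-- `n r s t i` is by definition `runner t (r + s) i`.
residueCount-v : ∀ r s t .{{_ : NonZero t}} α → α ∈𝒫[ r , s ] → ∀ i → i < t →
  residueCount t (betas r (row α)) i ≡ ones (v r s t α i)
residueCount-v r s t α α∈𝒫 i i<t = trans
  (residueCount-ones t (r + s) word (width-descending α (proj₂ α∈𝒫))
    (λ z _ → ⇔.trans (does-⇔ (bead? α _)) (bead⇔ r α z (∈𝒫-vanishes α α∈𝒫))) i i<t)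
  (cong (ones {m = n r s t i}) (tabulate-cong λ k → cong (abacus α) (sym (ℤ.+-assoc (ℤ.- pos r) (pos i) (pos (t * toℕ k))))))
  where
  word : ℕ → Bool
  word z = abacus α (ℤ.- pos r ℤ.+ pos z)

rimHooks-⊆ : ∀ {t α β} → Star (RimHook t) α β → β ⊆ α
rimHooks-⊆ ε              k = ≤-refl
rimHooks-⊆ (hook ◅ hooks) k = ≤-trans (rimHooks-⊆ hooks k) (RimHook.contained hook k)

-- The partitions with core `ρ`

module _ {r s t : ℕ} .{{_ : NonZero t}} (t>0 : 0 < t)
  {ρ : Partition} (ρ∈𝒫 : ρ ∈𝒫[ r , s ]) (core : IsCore t ρ) where

  core-flush : Flush t (betas r (row ρ))
  core-flush = ¬slidable⇒flush (proj₂ core ∘ slidable⇒rimHook t>0 r ρ (∈𝒫-vanishes ρ ρ∈𝒫))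

  -- Removing hooks from `α` ends at a flush `β` with unchanged counts; `ρ` is flush with the same
  -- counts, so `β` is `ρ`.
  residues⇒coreOf : ∀ {α} → α ∈𝒫[ r , s ] →
    (∀ i → i < t → residueCount t (betas r (row α)) i ≡ residueCount t (betas r (row ρ)) i) →
    CoreOf t α ρ
  residues⇒coreOf {α} α∈𝒫 counts =
    let α-van = ∈𝒫-vanishes α α∈𝒫
        β , hooks , flush = remove-rimHooks t>0 r α α-van
        β⊆α = rimHooks-⊆ hooks
        betas≡ = flush-determined t (r + s)
          (width-descending β (≤-trans (β⊆α 0) (proj₂ α∈𝒫))) (width-descending ρ (proj₂ ρ∈𝒫)) flush core-flush
          (λ i i<t → trans (sym (rimHooks-residueCount t t>0 r hooks α-van i)) (counts i i<t))
        β≡ρ = betas-determine β ρ (⊆-vanishes α β β⊆α α-van) (∈𝒫-vanishes ρ ρ∈𝒫) betas≡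
    in subst (Star (RimHook t) α) β≡ρ hooks , proj₂ core

  𝒟-cardinality : HasCardinality (𝒟 r s t ρ)
    (Π< t (λ i → runner t (r + s) i C residueCount t (betas r (row ρ)) i))
  𝒟-cardinality = cardinality-transfer (betas r ∘ row) configuration injective surjective
    (configuration-cardinality t (r + s) (residueCount t (betas r (row ρ))))
    where
    configuration : ∀ {α} → 𝒟 r s t ρ α →
      Configuration t (r + s) (residueCount t (betas r (row ρ))) (betas r (row α))
    configuration {α} (α∈𝒫 , hooks , _) =
      width-descending α (proj₂ α∈𝒫) ,
      λ i _ → rimHooks-residueCount t t>0 r hooks (∈𝒫-vanishes α α∈𝒫) i
    injective : ∀ {α β} → 𝒟 r s t ρ α → 𝒟 r s t ρ β → betas r (row α) ≡ betas r (row β) → α ≡ β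
    injective {α} {β} (α∈𝒫 , _) (β∈𝒫 , _) =
      betas-determine α β (∈𝒫-vanishes α α∈𝒫) (∈𝒫-vanishes β β∈𝒫)
    surjective : ∀ {bs} → Configuration t (r + s) (residueCount t (betas r (row ρ))) bs →
      ∃[ α ] 𝒟 r s t ρ α × betas r (row α) ≡ bs
    surjective {bs} (bs↘ , counts) =
      let α , α∈𝒫 , eq = betas-surjective bs↘ length≡r
      in α , (α∈𝒫 , residues⇒coreOf α∈𝒫 (λ i i<t →
           trans (cong (λ xs → residueCount t xs i) eq) (counts i i<t))) , eq
      where
      open ≡-Reasoning
      -- A configuration does not prescribe how many beads there are in total, but the runner counts
      -- add up to that number, and for `ρ` it is `r`.
      length≡r : length bs ≡ r
      length≡r = begin
        length bs                                  ≡⟨ Σ-residueCount t bs ⟨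
        Σ< t (residueCount t bs)                   ≡⟨ Σ<-cong t counts ⟩
        Σ< t (residueCount t (betas r (row ρ)))    ≡⟨ Σ-residueCount t (betas r (row ρ)) ⟩
        length (betas r (row ρ))                   ≡⟨ length-betas r (row ρ) ⟩
        r                                          ∎

corollary4p3 : (r s t : ℕ) .{{_ : NonZero t}} →
    1 ≤ r → 1 ≤ s → 2 ≤ t →
    (ρ : Partition) → ρ ∈𝒫[ r , s ] → IsCore t ρ →
    HasCardinality (𝒟 r s t ρ)
    (product (map (λ i → n r s t i C ones (v r s t ρ i)) (upTo t)))
corollary4p3 r s t _ _ 2≤t ρ ρ∈𝒫 core = subst (HasCardinality (𝒟 r s t ρ))
  (begin
    Π< t (λ i → n r s t i C residueCount t (betas r (row ρ)) i)
      ≡⟨ Π<-cong t (λ i i<t → cong (n r s t i C_) (residueCount-v r s t ρ ρ∈𝒫 i i<t)) ⟩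
    Π< t (λ i → n r s t i C ones (v r s t ρ i))
      ≡⟨ cong product (map-upTo (λ i → n r s t i C ones (v r s t ρ i)) t) ⟨
    product (map (λ i → n r s t i C ones (v r s t ρ i)) (upTo t)) ∎)
  (𝒟-cardinality (<⇒≤ 2≤t) ρ∈𝒫 core)
  where open ≡-Reasoning
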